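{- Let $d\ge1$ be a constant and $C>0$ a constant. Consider the store-and-forward packet routing problem on a $d$-dimensional uni-directional grid $G$ with $n$ nodes, uniform link capacity $c$ and uniform buffer size $B$. Let $\nu = 2n(d+B/c)$, $p_{\max} = (\nu+2)\cdot\mathrm{diam}(G)$ and $k=\lceil \log_2(1+3p_{\max})\rceil$. If $B/c \le n^{C}$ and $B, c \ge k$, then there exists an online deterministic centralized packet-routing algorithm with competitive ratio $O(\log n)$ in which every packet is either rejected upon arrival or delivered (no packet is preempted).
   Context: Store-and-forward packet routing model. The network is a directed graph $G=(V,E)$ with $n=|V|$ nodes; each edge can carry at most $c$ packets per time step (traversal takes one time step); each node can store at most $B$ packets. Time is discrete and synchronous. Each request $r_i=(a_i,b_i,t_i,d_i)$ has source $a_i$, destination $b_i$, input time $t_i$ (the packet is input at $a_i$ via a local input; any number per node per step) and deadline $d_i$ (possibly $\infty$). In each time step each node delivers packets destined to it, forwards at most $c$ of the other present packets along each outgoing edge, stores at most $B$, and deletes the rest. Deleting a locally input packet is rejection; deleting an injected packet before delivery is preemption. Throughput = number of packets delivered by their deadline. An online algorithm learns nothing about $r_i$ before $t_i$. A deterministic online ALG is $\rho$-competitive if $|\mathrm{ALG}(\sigma)|\ge\frac1\rho|\mathrm{OPT}(\sigma)|$ for all inputs $\sigma$, with $|\mathrm{OPT}(\sigma)|$ the maximum achievable throughput. A $d$-dimensional uni-directional grid has vertex set $[\ell_1]\times\cdots\times[\ell_d]$, $n=\prod_j\ell_j$, with a directed edge from $x$ to $x+e_j$ for each coordinate $j$ whenever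 both are vertices; requests satisfy $a_i\le b_i$ coordinatewise. $\mathrm{diam}(G)$ is the maximum over pairs $u,v$ with a directed path from $u$ to $v$ of the length of a shortest such path. -}

module Defs where

open import Data.Bool.Base using (if_then_else_)
open import Data.Fin.Base using (Fin; toℕ)
import Data.Fin.Properties as Fin
open import Data.Fin.Subset using (Subset; _∈_; ∣_∣)
import Data.Integer.Base as ℤ
open import Data.List.Base using (List; length; lookup; filter)
open import Data.List.Relation.Unary.All using (All)
open import Data.List.Relation.Unary.AllPairs using (AllPairs)
open import Data.Maybe.Base using (Maybe)
import Data.Maybe.Relation.Unary.All as Maybe
open import Data.Nat.Base using (ℕ; zero; suc; NonZero; _+_; _*_; _^_; _≤_)
import Data.Nat.Properties as ℕ
open import Data.Nat.Logarithm using (⌈log₂_⌉)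
open import Data.Product.Base using (Σ; ∃; ∃₂; _×_; _,_)
import Data.Rational.Unnormalised.Base as ℚᵘ
open import Data.Rational.Unnormalised.Base using (ℚᵘ; ↥_; ↧ₙ_; 0ℚᵘ)
open import Data.Sum.Base using (_⊎_)
open import Data.Vec.Base as Vec using (Vec; _[_]%=_)
import Data.Vec.Relation.Unary.All as Vec
open import Data.Vec.Relation.Binary.Pointwise.Inductive using (Pointwise)
open import Function.Bundles using (_⇔_)
open import Relation.Binary.Construct.Closure.ReflexiveTransitive using (Star; fold)
open import Relation.Binary.Definitions using (DecidableEquality)
open import Relation.Binary.PropositionalEquality.Core using (_≡_; refl)
open import Relation.Nullary using (¬_; does; yes; no)

record Digraph : Set₁ where
  infix 4 _≟_ _⟶_
  field
    V    : Set
    _≟_  : DecidableEquality V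
    _⟶_ : V → V → Set

module _ (G : Digraph) where
  open Digraph G

  pathLength : ∀ {u v} → Star _⟶_ u v → ℕ
  pathLength = fold (λ _ _ → ℕ) (λ _ → suc) 0

  IsDistance : V → V → ℕ → Set
  IsDistance u v m =
    (∃ λ (p : Star _⟶_ u v) → pathLength p ≡ m) ×
    (∀ (p : Star _⟶_ u v) → m ≤ pathLength p)

  -- Only pairs joined by a directed path have a distance, so this is the
  -- maximum over exactly those pairs.
  IsDiameter : ℕ → Set
  IsDiameter D =
    (∃₂ λ u v → IsDistance u v D) ×
    (∀ u v m → IsDistance u v m → m ≤ D)

HasSize : ∀ {m} → (Fin m → Set) → ℕ → Set
HasSize {m} P k = Σ (Subset m) λ X → (∀ i → i ∈ X ⇔ P i) × ∣ X ∣ ≡ k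

AtMost : ∀ {m} → ℕ → (Fin m → Set) → Set
AtMost {m} k P = ∀ (X : Subset m) → (∀ i → i ∈ X → P i) → ∣ X ∣ ≤ k

-- c is the link capacity and B the buffer size; Admissible a b says that a
-- request from a to b may be issued.
module Routing (G : Digraph) (Admissible : Digraph.V G → Digraph.V G → Set)
               (c B : ℕ) where
  open Digraph G

  -- The deadline `nothing` is ∞.
  record Request : Set where
    constructor request
    field
      source      : V
      destination : V
      inputTime   : ℕ
      deadline    : Maybe ℕ

  open Request public

  -- Requests are listed in order of input time, so that the requests known
  -- at any given time form a prefix and an index into it identifies the same
  -- packet forever.
  record Input : Set where
    field
      requests   : List Request
      sorted     : AllPairs (λ r s → inputTime r ≤ inputTime s) requests
      admissible : All (λ r → Admissible (source r) (destination r)) requests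

    Packet : Set
    Packet = Fin (length requests)

    req : Packet → Request
    req = lookup requests

  open Input public

  -- What is done in one time step with a packet present at a node other than
  -- its destination.
  data Action : Set where
    forward : V → Action
    store   : Action
    delete  : Action

  -- The situation of a packet in a time step after link arrivals, local
  -- inputs and deliveries, but before the action of that step.
  -- `delivered` and `deleted` record the time of the event.
  data Status : Set where
    awaited   : Status
    at        : V → Status
    delivered : ℕ → Status
    deleted   : ℕ → Status

  module _ (r : Request) where

    arrive : ℕ → V → Status
    arrive t v = if does (v ≟ destination r) then delivered t else at v

    input : ℕ → Status
    input t = if does (t ℕ.≟ inputTime r) then arrive t (source r) else awaited

    next : ℕ → Action → Status → Status
    next t a           awaited       = input (suc t)
    next t (forward w) (at v)        = arrive (suc t) w
    next t store       (at v)        = at v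
    next t delete      (at v)        = deleted t
    next t a           (delivered s) = delivered s
    next t a           (deleted s)   = deleted s

    status : (ℕ → Action) → ℕ → Status
    status plan zero    = input zero
    status plan (suc t) = next t (plan t) (status plan t)

  module _ (σ : Input) where

    Schedule : Set
    Schedule = Packet σ → ℕ → Action

    module _ (S : Schedule) where

      statusOf : Packet σ → ℕ → Status
      statusOf i = status (req σ i) (S i)

      Forwarded : V → V → ℕ → Packet σ → Set
      Forwarded u v t i = statusOf i t ≡ at u × S i t ≡ forward v

      Stored : V → ℕ → Packet σ → Set
      Stored v t i = statusOf i t ≡ at v × S i t ≡ store

      record Feasible : Set where
        field
          alongEdges   : ∀ u v t i → Forwarded u v t i → u ⟶ v
          linkCapacity : ∀ u v t → AtMost c (Forwarded u v t)
          bufferSize   : ∀ v t → AtMost B (Stored v t)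

      DeliveredAt : ℕ → Packet σ → Set
      DeliveredAt s i = ∃ λ t → statusOf i t ≡ delivered s

      Delivered : Packet σ → Set
      Delivered i = ∃ λ s → DeliveredAt s i

      DeliveredOnTime : Packet σ → Set
      DeliveredOnTime i =
        ∃ λ s → DeliveredAt s i × Maybe.All (s ≤_) (deadline (req σ i))

      Rejected : Packet σ → Set
      Rejected i = ∃ λ t → statusOf i t ≡ deleted (inputTime (req σ i))

      Throughput : ℕ → Set
      Throughput = HasSize DeliveredOnTime

    IsOPT : ℕ → Set
    IsOPT o =
      (∃ λ S → Feasible S × Throughput S o) ×
      (∀ S k → Feasible S → Throughput S k → k ≤ o)

  known : ℕ → Input → List Request
  known t σ = filter (λ r → inputTime r ℕ.≤? t) (requests σ)

  -- `A t rs i` is the decision in step t on the packet at position i of the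
  -- list rs of all requests input up to and including step t.  All past
  -- decisions are determined by rs.  Values at positions outside rs are
  -- irrelevant.
  OnlineAlgorithm : Set
  OnlineAlgorithm = ℕ → List Request → ℕ → Action

  run : OnlineAlgorithm → (σ : Input) → Schedule σ
  run A σ i t = A t (known t σ) (toℕ i)

  AlwaysFeasible : OnlineAlgorithm → Set
  AlwaysFeasible A = ∀ σ → Feasible σ (run A σ)

  Competitive : ℕ → OnlineAlgorithm → Set
  Competitive ρ A =
    ∀ σ → ∃ λ a → Throughput σ (run A σ) a × (∀ o → IsOPT σ o → o ≤ ρ * a)

  NonPreemptive : OnlineAlgorithm → Set
  NonPreemptive A =
    ∀ σ i → Rejected σ (run A σ) i ⊎ Delivered σ (run A σ) i

-- Coordinates are counted from 0.
Vertex : ∀ {d} → Vec ℕ d → Set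
Vertex = Vec.All Fin

coords : ∀ {d} {ℓ : Vec ℕ d} → Vertex ℓ → Vec ℕ d
coords = Vec.reduce toℕ

_≟ⱽ_ : ∀ {d} {ℓ : Vec ℕ d} → DecidableEquality (Vertex ℓ)
Vec.[] ≟ⱽ Vec.[] = yes refl
(x Vec.∷ xs) ≟ⱽ (y Vec.∷ ys) with x Fin.≟ y | xs ≟ⱽ ys
... | yes refl | yes refl = yes refl
... | no x≢y   | _        = no λ { refl → x≢y refl }
... | yes _    | no xs≢ys = no λ { refl → xs≢ys refl }

Grid : ∀ {d} → Vec ℕ d → Digraph
Grid ℓ = record
  { V    = Vertex ℓ
  ; _≟_  = _≟ⱽ_
  ; _⟶_ = λ x y → ∃ λ j → coords y ≡ coords x [ j ]%= suc
  }

_≤ⱽ_ : ∀ {d} {ℓ : Vec ℕ d} → Vertex ℓ → Vertex ℓ → Set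
x ≤ⱽ y = Pointwise _≤_ (coords x) (coords y)

gridSize : ∀ {d} → Vec ℕ d → ℕ
gridSize = Vec.foldr _ _*_ 1

module GridRouting {d} (ℓ : Vec ℕ d) (c B : ℕ) = Routing (Grid ℓ) _≤ⱽ_ c B

fromℕ : ℕ → ℚᵘ
fromℕ m = ℤ.+ m ℚᵘ./ 1

module Parameters (n d c B diam : ℕ) .{{_ : NonZero c}} where

  ν : ℚᵘ
  ν = fromℕ (2 * n) ℚᵘ.* (fromℕ d ℚᵘ.+ ℤ.+ B ℚᵘ./ c)

  pmax : ℚᵘ
  pmax = (ν ℚᵘ.+ fromℕ 2) ℚᵘ.* fromℕ diam

  -- For rational x ≥ 1, ⌈log₂ x⌉ = ⌈log₂ ⌈x⌉⌉, as powers of 2 are integers.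
  k : ℕ
  k = ⌈log₂ ℤ.∣ ℚᵘ.ceiling (fromℕ 1 ℚᵘ.+ fromℕ 3 ℚᵘ.* pmax) ∣ ⌉

-- Dedekind cuts; the lower and upper parts are automatically closed under the
-- equality of unnormalised rationals because they are rounded.
record ℝ : Set₁ where
  field
    Lower Upper   : ℚᵘ → Set
    lowerNonempty : ∃ Lower
    upperNonempty : ∃ Upper
    lowerRounded  : ∀ p → Lower p ⇔ ∃ λ q → p ℚᵘ.< q × Lower q
    upperRounded  : ∀ p → Upper p ⇔ ∃ λ q → q ℚᵘ.< p × Upper q
    disjoint      : ∀ p → ¬ (Lower p × Upper p)
    located       : ∀ p q → p ℚᵘ.< q → Lower p ⊎ Upper q

open ℝ public

Positive : ℝ → Set
Positive C = Lower C 0ℚᵘ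

-- B/c ≤ n^C for c, n ≥ 1 and C > 0: by continuity and monotonicity n^C is the
-- infimum of n^q over the rationals q > C, and B/c ≤ n^(p/r) means
-- B^r ≤ c^r n^p.  As q > C > 0, the absolute value of the numerator is the
-- numerator itself.
RatioAtMostPower : (B c n : ℕ) → ℝ → Set
RatioAtMostPower B c n C =
  ∀ q → Upper C q → B ^ ↧ₙ q ≤ c ^ ↧ₙ q * n ^ ℤ.∣ ↥ q ∣

{-# OPTIONS --safe #-}

-- A packet travels along a path in the space-time graph, whose edges (v , m , t)
-- say that move m is made at v in step t.  Give an edge of capacity u the weight
-- 2 ^ (load / ⌊u / k⌋) and route each request greedily along some path of total
-- weight < 2 ^ k, rejecting it if there is none.  A full edge has weight at least
-- 2 ^ k, so capacities are respected.
--
-- For the competitive ratio, let i be a packet delivered by OPT and rejected by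
-- the algorithm.  OPT may keep i for very long, whereas only paths with at most
-- 2 ^ (k - 1) edges are known to be too heavy because of the load on them and
-- not just because of their length.  Therefore i is charged to T paths: the s-th
-- one follows OPT for s steps and then goes to the destination without being
-- stored.  At any time OPT has at most n (B + d c) packets in the network, so
-- these detours load a link at most diam * n (B + d c) ≤ T c times, and the T
-- paths of all packets together load each edge at most 2 T u times.  Since the
-- total weight is paid for by the accepted packets, the rejected ones number at
-- most 8 k times the accepted ones.
module Submission where

open import Defs
open import Data.Bool.Base using (Bool; true; false; if_then_else_)
open import Data.Fin.Base using (Fin; zero; suc; toℕ; fromℕ<)
import Data.Fin.Properties as Fin
open import Data.Fin.Subset as Subset using (Subset; ∣_∣)
import Data.Integer.Base as ℤ
import Data.Integer.DivMod as ℤ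
import Data.Integer.Properties as ℤ
open import Data.Integer.Tactic.RingSolver using () renaming (solve-∀ to ℤ-solve-∀)
open import Data.List.Base using (List; []; _∷_; _++_; length; lookup; map; filter; foldl; upTo; concatMap; allFin; cartesianProductWith)
open import Data.List.Membership.Propositional using (_∈_; lose)
open import Data.List.Membership.Propositional.Properties using (∈-++⁺ˡ; ∈-++⁺ʳ; ∈-map⁺; ∈-allFin; ∈-upTo⁻; ∈-cartesianProductWith⁺; ∈-lookup)
open import Data.List.Properties using (map-tabulate; map-applyUpTo; filter-accept; length-upTo; length-tabulate; length-++; length-map)
import Data.List.Relation.Unary.All as All
open import Data.List.Relation.Unary.AllPairs as AllPairs using (AllPairs)
open import Data.List.Relation.Unary.Any as Any using (Any; here; there)
open import Data.Maybe.Base using (Maybe; just; nothing; fromMaybe; is-just)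
import Data.Maybe.Properties as Maybe
open import Data.Maybe.Properties using (just-injective)
import Data.Maybe.Relation.Unary.All as Maybe
open import Data.Nat.Base
open import Data.Nat.Divisibility using (divides)
open import Data.Nat.DivMod
open import Data.Nat.Induction using (<-rec)
open import Data.Nat.Logarithm
open import Data.Nat.Properties
open import Data.Nat.Tactic.RingSolver using (solve-∀)
open import Data.Product.Base using (∃; ∃₂; _×_; _,_; proj₁; proj₂)
import Data.Product.Properties as Product
import Data.Rational.Unnormalised.Base as ℚᵘ
open import Data.Rational.Unnormalised.Base using (ℚᵘ; mkℚᵘ; ↥_; ↧ₙ_)
open import Data.Sum.Base using (_⊎_; inj₁; inj₂)
open import Data.Unit.Base using (⊤; tt)
open import Data.Vec.Base as Vec using (Vec; []; _∷_; _[_]%=_)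
import Data.Vec.Properties as Vec
import Data.Vec.Relation.Unary.All as Allᵛ
open import Function.Base using (_∘_; id; it; _$_)
open import Function.Bundles using (_⇔_; mk⇔; Equivalence)
open import Relation.Binary.Construct.Closure.ReflexiveTransitive using (Star; ε; _◅_)
open import Relation.Binary.Definitions using (Decidable; DecidableEquality)
open import Relation.Binary.PropositionalEquality
open import Relation.Nullary
open import Relation.Nullary.Decidable using (_×-dec_; ¬?; dec-true; dec-false)
import Relation.Unary as Unary

-- Finite sums

∑ : {X : Set} → (X → ℕ) → List X → ℕ
∑ f []       = 0
∑ f (x ∷ xs) = f x + ∑ f xs

⟦_⟧ : Bool → ℕ
⟦ false ⟧ = 0
⟦ true  ⟧ = 1

module _ {X : Set} where

  ∑-mono : {f g : X → ℕ} → (∀ x → f x ≤ g x) → ∀ xs → ∑ f xs ≤ ∑ g xs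
  ∑-mono f≤g []       = z≤n
  ∑-mono f≤g (x ∷ xs) = +-mono-≤ (f≤g x) (∑-mono f≤g xs)

  ∑-cong : {f g : X → ℕ} → (∀ x → f x ≡ g x) → ∀ xs → ∑ f xs ≡ ∑ g xs
  ∑-cong f≡g []       = refl
  ∑-cong f≡g (x ∷ xs) = cong₂ _+_ (f≡g x) (∑-cong f≡g xs)

  ∑-const : ∀ m (xs : List X) → ∑ (λ _ → m) xs ≡ length xs * m
  ∑-const m []       = refl
  ∑-const m (x ∷ xs) = cong (m +_) (∑-const m xs)

  ∑-zero : (xs : List X) → ∑ (λ _ → 0) xs ≡ 0
  ∑-zero xs = trans (∑-const 0 xs) (*-zeroʳ (length xs))

  ∑-+ : ∀ (f g : X → ℕ) xs → ∑ (λ x → f x + g x) xs ≡ ∑ f xs + ∑ g xs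
  ∑-+ f g []       = refl
  ∑-+ f g (x ∷ xs) = trans (cong (f x + g x +_) (∑-+ f g xs))
                           (interchange (f x) (g x) (∑ f xs) (∑ g xs))
    where
    interchange : ∀ a b c d → a + b + (c + d) ≡ a + c + (b + d)
    interchange = solve-∀

  ∑-*ˡ : ∀ m (f : X → ℕ) xs → ∑ (λ x → m * f x) xs ≡ m * ∑ f xs
  ∑-*ˡ m f []       = sym (*-zeroʳ m)
  ∑-*ˡ m f (x ∷ xs) = trans (cong (m * f x +_) (∑-*ˡ m f xs))
                            (sym (*-distribˡ-+ m (f x) (∑ f xs)))

  ∑-*ʳ : ∀ m (f : X → ℕ) xs → ∑ (λ x → f x * m) xs ≡ ∑ f xs * m
  ∑-*ʳ m f xs = trans (∑-cong (λ x → *-comm (f x) m) xs)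
                      (trans (∑-*ˡ m f xs) (*-comm m (∑ f xs)))

  ∑-++ : ∀ (f : X → ℕ) xs ys → ∑ f (xs ++ ys) ≡ ∑ f xs + ∑ f ys
  ∑-++ f []       ys = refl
  ∑-++ f (x ∷ xs) ys = trans (cong (f x +_) (∑-++ f xs ys))
                             (sym (+-assoc (f x) (∑ f xs) (∑ f ys)))

  ∑-∈ : ∀ (f : X → ℕ) {x xs} → x ∈ xs → f x ≤ ∑ f xs
  ∑-∈ f (here refl)  = m≤m+n _ _
  ∑-∈ f (there x∈xs) = ≤-trans (∑-∈ f x∈xs) (m≤n+m _ _)

module _ {X Y : Set} where

  ∑-map : ∀ (f : Y → ℕ) (g : X → Y) xs → ∑ f (map g xs) ≡ ∑ (f ∘ g) xs
  ∑-map f g []       = refl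
  ∑-map f g (x ∷ xs) = cong (f (g x) +_) (∑-map f g xs)

  ∑-concatMap : ∀ (f : Y → ℕ) (g : X → List Y) xs →
                ∑ f (concatMap g xs) ≡ ∑ (∑ f ∘ g) xs
  ∑-concatMap f g []       = refl
  ∑-concatMap f g (x ∷ xs) = trans (∑-++ f (g x) (concatMap g xs))
                                   (cong (∑ f (g x) +_) (∑-concatMap f g xs))

  ∑-comm : ∀ (h : X → Y → ℕ) xs ys →
           ∑ (λ x → ∑ (h x) ys) xs ≡ ∑ (λ y → ∑ (λ x → h x y) xs) ys
  ∑-comm h []       ys = sym (∑-zero ys)
  ∑-comm h (x ∷ xs) ys = trans (cong (∑ (h x) ys +_) (∑-comm h xs ys))
                               (sym (∑-+ (h x) (λ y → ∑ (λ x′ → h x′ y) xs) ys))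

∑-allFin : ∀ {m} (f : Fin (suc m) → ℕ) →
           ∑ f (allFin (suc m)) ≡ f zero + ∑ (f ∘ suc) (allFin m)
∑-allFin {m} f =
  cong (f zero +_) (trans (cong (∑ f) (sym (map-tabulate id suc))) (∑-map f suc (allFin m)))

∣∣≡∑ : ∀ {m} (X : Subset m) → ∣ X ∣ ≡ ∑ (⟦_⟧ ∘ Vec.lookup X) (allFin m)
∣∣≡∑ [] = refl
∣∣≡∑ X@(true  ∷ X′) = trans (cong suc (∣∣≡∑ X′)) (sym (∑-allFin (⟦_⟧ ∘ Vec.lookup X)))
∣∣≡∑ X@(false ∷ X′) = trans (∣∣≡∑ X′) (sym (∑-allFin (⟦_⟧ ∘ Vec.lookup X)))

⟦⟧-≤ : ∀ {P : Set} (P? : Dec P) {n} → (P → 1 ≤ n) → ⟦ does P? ⟧ ≤ n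
⟦⟧-≤ (yes p) 1≤n = 1≤n p
⟦⟧-≤ (no  _) _   = z≤n

⟦⟧-true : ∀ {P : Set} (P? : Dec P) → P → ⟦ does P? ⟧ ≡ 1
⟦⟧-true (yes _) _ = refl
⟦⟧-true (no ¬p) p = contradiction p ¬p

⟦⟧-false : ∀ {P : Set} (P? : Dec P) → ¬ P → ⟦ does P? ⟧ ≡ 0
⟦⟧-false (yes p) ¬p = contradiction p ¬p
⟦⟧-false (no _)  _  = refl

-- Greedy admission with exponential weights

count : {E : Set} → DecidableEquality E → E → List E → ℕ
count _≟_ e = ∑ (λ e′ → ⟦ does (e ≟ e′) ⟧)

-- One more unit of load multiplies the weight by 2 only when it completes a
-- block of q units; interpolating linearly inside the blocks makes the
-- increment exactly 2 ^ (L / q).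
interpolate-suc : ∀ L q .{{_ : NonZero q}} →
                  (q + suc L % q) * 2 ^ (suc L / q) ≡ 2 ^ (L / q) + (q + L % q) * 2 ^ (L / q)
interpolate-suc L q with suc (L % q) <? q
... | yes b<q = begin-equality
  (q + suc L % q) * 2 ^ (suc L / q)       ≡⟨ cong₂ (λ x y → (q + x) * 2 ^ y) rem quot ⟩
  (q + suc (L % q)) * 2 ^ (L / q)         ≡⟨ cong (_* 2 ^ (L / q)) (+-suc q (L % q)) ⟩
  2 ^ (L / q) + (q + L % q) * 2 ^ (L / q) ∎
  where
  open ≤-Reasoning
  decompose : suc L ≡ suc (L % q) + (L / q) * q
  decompose = cong suc (m≡m%n+[m/n]*n L q)
  rem : suc L % q ≡ suc (L % q)
  rem = trans (cong (_% q) decompose)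
              (trans ([m+kn]%n≡m%n (suc (L % q)) (L / q) q) (m<n⇒m%n≡m b<q))
  quot : suc L / q ≡ L / q
  quot = trans (cong (_/ q) decompose)
        (trans (+-distrib-/-∣ʳ (suc (L % q)) (divides (L / q) refl))
               (cong₂ _+_ (m<n⇒m/n≡0 b<q) (m*n/n≡m (L / q) q)))
... | no  b≮q = begin-equality
  (q + suc L % q) * 2 ^ (suc L / q)         ≡⟨ cong₂ (λ x y → (q + x) * 2 ^ y) rem quot ⟩
  (q + 0) * (2 * 2 ^ (L / q))               ≡⟨ double q (2 ^ (L / q)) ⟩
  q * 2 ^ (L / q) + q * 2 ^ (L / q)         ≡⟨ cong (λ x → x * 2 ^ (L / q) + q * 2 ^ (L / q)) b≡q ⟨
  suc (L % q) * 2 ^ (L / q) + q * 2 ^ (L / q) ≡⟨ regroup (L % q) q (2 ^ (L / q)) ⟩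
  2 ^ (L / q) + (q + L % q) * 2 ^ (L / q)   ∎
  where
  open ≤-Reasoning
  double : ∀ q x → (q + 0) * (2 * x) ≡ q * x + q * x
  double = solve-∀
  regroup : ∀ b q x → suc b * x + q * x ≡ x + (q + b) * x
  regroup = solve-∀
  b≡q : suc (L % q) ≡ q
  b≡q = ≤-antisym (m%n<n L q) (≮⇒≥ b≮q)
  decompose : suc L ≡ suc (L / q) * q
  decompose = trans (cong suc (m≡m%n+[m/n]*n L q)) (cong (_+ (L / q) * q) b≡q)
  rem : suc L % q ≡ 0
  rem = trans (cong (_% q) decompose) (m*n%n≡0 (suc (L / q)) q)
  quot : suc L / q ≡ suc (L / q)
  quot = trans (cong (_/ q) decompose) (m*n/n≡m (suc (L / q)) q)

module Greedy {E : Set} (_≟_ : DecidableEquality E)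
              (q : E → ℕ) {{q≢0 : ∀ {e} → NonZero (q e)}} (k : ℕ) where

  open import Data.List.Membership.DecPropositional _≟_ using (_∈?_) public

  load : List (List E) → E → ℕ
  load A e = ∑ (λ p → ⟦ does (e ∈? p) ⟧) A

  weight : List (List E) → E → ℕ
  weight A e = 2 ^ (load A e / q e)

  cost : List (List E) → List E → ℕ
  cost A = ∑ (weight A)

  -- The most recently accepted path comes first, so each path was cheap with
  -- respect to those behind it.
  data Affordable : List (List E) → Set where
    []  : Affordable []
    _∷_ : ∀ {p A} → cost A p < 2 ^ k → Affordable A → Affordable (p ∷ A)

  weight-mono : ∀ {A A′} e → load A e ≤ load A′ e → weight A e ≤ weight A′ e
  weight-mono e l≤l′ = ^-monoʳ-≤ 2 (/-monoˡ-≤ (q e) l≤l′)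

  1≤weight : ∀ A e → 1 ≤ weight A e
  1≤weight A e = m^n>0 2 (load A e / q e)

  -- The weight of e is one summand in the cost of the last path accepted through e. It was
  -- therefore below 2 ^ k at that time, so that fewer than k blocks of q e units were complete.
  load≤k*q : ∀ {A} → Affordable A → ∀ e → load A e ≤ k * q e
  load≤k*q [] e = z≤n
  load≤k*q {p ∷ A} (cheap ∷ aff) e with e ∈? p
  ... | no  _   = load≤k*q aff e
  ... | yes e∈p = begin
    suc (load A e)                          ≤⟨ m<[1+m/n]*n (load A e) ⟩
    suc (load A e / q e) * q e ≤⟨ *-monoˡ-≤ (q e) L/q<k ⟩
    k * q e                                 ∎
    where
    open ≤-Reasoning
    m<[1+m/n]*n : ∀ m → m < suc (m / q e) * q e
    m<[1+m/n]*n m = begin-strict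
      m                                          ≡⟨ m≡m%n+[m/n]*n m (q e) ⟩
      m % q e + m / q e * q e <⟨ +-monoˡ-< _ (m%n<n m (q e)) ⟩
      suc (m / q e) * q e          ∎
    L/q<k : load A e / q e < k
    L/q<k = ≰⇒> λ k≤L/q →
      <⇒≱ (≤-<-trans (∑-∈ (weight A) e∈p) cheap) (^-monoʳ-≤ 2 k≤L/q)

  -- What e has earned: each accepted path through e contributes the weight that e had when the path
  -- was accepted, that is, its share in the cost of the path.
  potential : List (List E) → E → ℕ
  potential []      e = 0
  potential (p ∷ A) e = ⟦ does (e ∈? p) ⟧ * weight A e + potential A e

  -- The left side is the interpolated weight, scaled by q e. It is q e at load 0, and by
  -- `interpolate-suc` each accepted path through e raises it by the current weight, which is
  -- exactly what the potential gains.
  interpolation : ∀ A e → (q e + load A e % q e) * weight A e ≡ q e + potential A e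
  interpolation [] e
    = trans (cong₂ (λ r l → (q e + r) * 2 ^ l) (m*n%n≡0 0 (q e)) (0/n≡0 (q e))) (*-identityʳ (q e + 0))
  interpolation (p ∷ A) e with e ∈? p
  ... | no  _ = interpolation A e
  ... | yes _ = begin-equality
    _                                       ≡⟨ interpolate-suc (load A e) (q e) ⟩
    weight A e + _                          ≡⟨ cong (weight A e +_) (interpolation A e) ⟩
    weight A e + (q e + potential A e)      ≡⟨ move (weight A e) (q e) (potential A e) ⟩
    q e + (weight A e + 0 + potential A e)  ∎
    where
    open ≤-Reasoning
    move : ∀ w q φ → w + (q + φ) ≡ q + (w + 0 + φ)
    move = solve-∀

  -- Drops the incomplete block from `interpolation`. Weight 1 is subtracted because an unloaded
  -- edge has that weight without having earned anything.
  q*[weight∸1]≤potential : ∀ A e → q e * (weight A e ∸ 1) ≤ potential A e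
  q*[weight∸1]≤potential A e = begin
    q e * (weight A e ∸ 1)              ≡⟨ *-distribˡ-∸ (q e) (weight A e) 1 ⟩
    q e * weight A e ∸ q e * 1          ≤⟨ ∸-mono (*-monoˡ-≤ (weight A e) (m≤m+n (q e) _)) (≤-reflexive (sym (*-identityʳ (q e)))) ⟩
    (q e + load A e % q e) * weight A e ∸ q e ≡⟨ cong (_∸ q e) (interpolation A e) ⟩
    q e + potential A e ∸ q e           ≡⟨ m+n∸m≡n (q e) _ ⟩
    potential A e                       ∎
    where open ≤-Reasoning

  -- Edges of different capacity have different q; the cofactors m bring them
  -- to the common value Q.
  module _ (m : E → ℕ) {Q N : ℕ} (q*m≡Q : ∀ e → q e * m e ≡ Q)
           (F : List E) (F-count : ∀ e → count _≟_ e F ≤ N * q e) where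

    open ≤-Reasoning

    -- After exchanging the sums over F and p, each edge e′ of p is counted at most N * q e′ times,
    -- and the cofactor turns this into N * Q.
    potential-step : ∀ A p → ∑ (λ e → m e * (⟦ does (e ∈? p) ⟧ * weight A e)) F ≤ N * Q * cost A p
    potential-step A p = begin
      ∑ (λ e → m e * (⟦ does (e ∈? p) ⟧ * weight A e)) F
        -- Membership in p is bounded by the number of occurrences in p, which makes both factors
        -- sums.
        ≤⟨ ∑-mono spread F ⟩
      ∑ (λ e → ∑ (λ e′ → ⟦ does (e′ ≟ e) ⟧ * (m e′ * weight A e′)) p) F
        ≡⟨ ∑-comm _ F p ⟩
      ∑ (λ e′ → ∑ (λ e → ⟦ does (e′ ≟ e) ⟧ * (m e′ * weight A e′)) F) p
        ≡⟨ ∑-cong (λ e′ → ∑-*ʳ (m e′ * weight A e′) _ F) p ⟩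
      ∑ (λ e′ → count _≟_ e′ F * (m e′ * weight A e′)) p
        ≤⟨ ∑-mono (λ e′ → *-monoˡ-≤ _ (F-count e′)) p ⟩
      ∑ (λ e′ → N * q e′ * (m e′ * weight A e′)) p
        ≡⟨ ∑-cong (λ e′ → trans (regroup N (q e′) (m e′) (weight A e′))
                                (cong (λ x → N * x * weight A e′) (q*m≡Q e′))) p ⟩
      ∑ (λ e′ → N * Q * weight A e′) p
        ≡⟨ ∑-*ˡ (N * Q) (weight A) p ⟩
      N * Q * cost A p ∎
      where
      regroup : ∀ N q m w → N * q * (m * w) ≡ N * (q * m) * w
      regroup = solve-∀
      spread : ∀ e → m e * (⟦ does (e ∈? p) ⟧ * weight A e) ≤
                     ∑ (λ e′ → ⟦ does (e′ ≟ e) ⟧ * (m e′ * weight A e′)) p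
      spread e with e ∈? p
      ... | no  _   = ≤-trans (≤-reflexive (*-zeroʳ (m e))) z≤n
      ... | yes e∈p = begin
        m e * (weight A e + 0)                         ≡⟨ unit (m e) (weight A e) ⟩
        1 * (m e * weight A e)                         ≡⟨ cong (_* (m e * weight A e)) (⟦⟧-true (e ≟ e) refl) ⟨
        ⟦ does (e ≟ e) ⟧ * (m e * weight A e)          ≤⟨ ∑-∈ _ e∈p ⟩
        ∑ (λ e′ → ⟦ does (e′ ≟ e) ⟧ * (m e′ * weight A e′)) p ∎
        where
        unit : ∀ m w → m * (w + 0) ≡ 1 * (m * w)
        unit = solve-∀

    potential-bound : ∀ {A} → Affordable A →
                      ∑ (λ e → m e * potential A e) F ≤ N * Q * (length A * 2 ^ k)
    potential-bound [] = ≤-trans (≤-reflexive (trans (∑-cong (λ e → *-zeroʳ (m e)) F) (∑-zero F))) z≤n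
    potential-bound {p ∷ A} (cheap ∷ aff) = begin
      ∑ (λ e → m e * potential (p ∷ A) e) F
        ≡⟨ trans (∑-cong (λ e → *-distribˡ-+ (m e) _ (potential A e)) F) (∑-+ _ _ F) ⟩
      ∑ (λ e → m e * (⟦ does (e ∈? p) ⟧ * weight A e)) F + ∑ (λ e → m e * potential A e) F
        ≤⟨ +-mono-≤ (potential-step A p) (potential-bound aff) ⟩
      N * Q * cost A p + N * Q * (length A * 2 ^ k)
        ≡⟨ *-distribˡ-+ (N * Q) (cost A p) _ ⟨
      N * Q * (cost A p + length A * 2 ^ k)
        ≤⟨ *-monoʳ-≤ (N * Q) (+-monoˡ-≤ _ (<⇒≤ cheap)) ⟩
      N * Q * (length (p ∷ A) * 2 ^ k) ∎

    -- The excess weight on F is paid for by the accepted paths: F visits e at most N * q e times, q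
    -- e times the excess is covered by the potential of e, and each accepted path brought in a
    -- total potential of less than 2 ^ k.
    charging : .{{_ : NonZero Q}} → ∀ {A} → Affordable A →
               ∑ (λ e → weight A e ∸ 1) F ≤ N * (length A * 2 ^ k)
    charging {A} aff = *-cancelˡ-≤ Q (begin
      Q * ∑ (λ e → weight A e ∸ 1) F             ≡⟨ ∑-*ˡ Q _ F ⟨
      ∑ (λ e → Q * (weight A e ∸ 1)) F           ≡⟨ ∑-cong (λ e → cong (_* (weight A e ∸ 1)) (q*m≡Q e)) F ⟨
      ∑ (λ e → q e * m e * (weight A e ∸ 1)) F   ≡⟨ ∑-cong (λ e → swap (q e) (m e) (weight A e ∸ 1)) F ⟩
      ∑ (λ e → m e * (q e * (weight A e ∸ 1))) F ≤⟨ ∑-mono (λ e → *-monoʳ-≤ (m e) (q*[weight∸1]≤potential A e)) F ⟩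
      ∑ (λ e → m e * potential A e) F            ≤⟨ potential-bound aff ⟩
      N * Q * (length A * 2 ^ k)                 ≡⟨ commute N Q (length A * 2 ^ k) ⟩
      Q * (N * (length A * 2 ^ k))               ∎)
      where
      swap : ∀ q m x → q * m * x ≡ m * (q * x)
      swap = solve-∀
      commute : ∀ N Q x → N * Q * x ≡ Q * (N * x)
      commute = solve-∀

-- Routes in the space-time graph

∑-upTo : ∀ (f : ℕ → ℕ) n → ∑ f (upTo (suc n)) ≡ f 0 + ∑ (f ∘ suc) (upTo n)
∑-upTo f n = cong (f 0 +_) (trans (cong (∑ f) (sym (map-applyUpTo id suc n))) (∑-map f suc (upTo n)))

-- The numbers s + t are distinct and at least t, so x is hit at most once, and not at all if x < t.
∑-shifted : ∀ T t x → ∑ (λ s → ⟦ does (s + t ≟ x) ⟧) (upTo T) ≤ ⟦ does (t ≤? x) ⟧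
∑-shifted zero    t x = z≤n
∑-shifted (suc T) t x = begin
  ∑ (λ s → ⟦ does (s + t ≟ x) ⟧) (upTo (suc T))
    ≡⟨ ∑-upTo _ T ⟩
  ⟦ does (t ≟ x) ⟧ + ∑ (λ s → ⟦ does (suc s + t ≟ x) ⟧) (upTo T)
    ≡⟨ cong (⟦ does (t ≟ x) ⟧ +_) (∑-cong (λ s → cong (λ y → ⟦ does (y ≟ x) ⟧) (+-suc s t)) (upTo T)) ⟨
  ⟦ does (t ≟ x) ⟧ + ∑ (λ s → ⟦ does (s + suc t ≟ x) ⟧) (upTo T)
    ≤⟨ +-monoʳ-≤ ⟦ does (t ≟ x) ⟧ (∑-shifted T (suc t) x) ⟩
  ⟦ does (t ≟ x) ⟧ + ⟦ does (suc t ≤? x) ⟧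
    ≤⟨ split (t ≟ x) ⟩
  ⟦ does (t ≤? x) ⟧ ∎
  where
  open ≤-Reasoning
  split : (t≟x : Dec (t ≡ x)) → ⟦ does t≟x ⟧ + ⟦ does (suc t ≤? x) ⟧ ≤ ⟦ does (t ≤? x) ⟧
  split (yes refl) = ≤-reflexive (trans (cong suc (⟦⟧-false (suc t ≤? t) (<-irrefl refl)))
                                        (sym (⟦⟧-true (t ≤? t) ≤-refl)))
  split (no  _)    = ⟦⟧-≤ (suc t ≤? x) λ t<x → ≤-reflexive (sym (⟦⟧-true (t ≤? x) (<⇒≤ t<x)))

-- Only s with s + t equal to x ∸ j can contribute, and there is at most one. If j > x, truncation
-- does no harm, since then every summand vanishes.
∑-shifted-≤ : ∀ (g : ℕ → ℕ) T t x j →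
              ∑ (λ s → ⟦ does (j + (s + t) ≟ x) ⟧ * g (s + t)) (upTo T) ≤ g (x ∸ j)
∑-shifted-≤ g T t x j = begin
  ∑ (λ s → ⟦ does (j + (s + t) ≟ x) ⟧ * g (s + t)) (upTo T) ≤⟨ ∑-mono (λ s → pinned s (j + (s + t) ≟ x)) (upTo T) ⟩
  ∑ (λ s → ⟦ does (s + t ≟ x ∸ j) ⟧ * g (x ∸ j)) (upTo T)   ≡⟨ ∑-*ʳ (g (x ∸ j)) _ (upTo T) ⟩
  ∑ (λ s → ⟦ does (s + t ≟ x ∸ j) ⟧) (upTo T) * g (x ∸ j)   ≤⟨ *-monoˡ-≤ (g (x ∸ j)) (∑-shifted T t (x ∸ j)) ⟩
  ⟦ does (t ≤? x ∸ j) ⟧ * g (x ∸ j)                         ≤⟨ *-monoˡ-≤ (g (x ∸ j)) (⟦⟧-≤ (t ≤? x ∸ j) λ _ → ≤-refl {1}) ⟩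
  1 * g (x ∸ j)                                             ≡⟨ *-identityˡ _ ⟩
  g (x ∸ j)                                                 ∎
  where
  open ≤-Reasoning
  pinned : ∀ s (hit? : Dec (j + (s + t) ≡ x)) →
           ⟦ does hit? ⟧ * g (s + t) ≤ ⟦ does (s + t ≟ x ∸ j) ⟧ * g (x ∸ j)
  pinned s (no  _)    = z≤n
  pinned s (yes refl) = ≤-reflexive (trans (cong (λ y → 1 * g y) s+t≡)
                                           (cong (_* g (x ∸ j)) (sym (⟦⟧-true (s + t ≟ x ∸ j) s+t≡))))
    where
    s+t≡ : s + t ≡ j + (s + t) ∸ j
    s+t≡ = sym (m+n∸m≡n j (s + t))

module SpaceTime (G : Digraph) (Admissible : Digraph.V G → Digraph.V G → Set) (c B : ℕ) where

  open Digraph G using (V; _⟶_) renaming (_≟_ to _≟ᵛ_)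
  open Routing G Admissible c B

  -- `nothing` stands for storing the packet, `just w` for forwarding it to w.
  Move : Set
  Move = Maybe V

  Edge : Set
  Edge = V × Move × ℕ

  _≟ᴱ_ : DecidableEquality Edge
  _≟ᴱ_ = Product.≡-dec _≟ᵛ_ (Product.≡-dec (Maybe.≡-dec _≟ᵛ_) _≟_)

  time : Edge → ℕ
  time (_ , _ , t) = t

  capacity : Edge → ℕ
  capacity (_ , nothing , _) = B
  capacity (_ , just _  , _) = c

  link : Edge → ℕ
  link (_ , m , _) = ⟦ is-just m ⟧

  edges : ℕ → V → List Move → List Edge
  edges t v []       = []
  edges t v (m ∷ ms) = (v , m , t) ∷ edges (suc t) (fromMaybe v m) ms

  Step : V → Move → Set
  Step v nothing  = ⊤
  Step v (just w) = v ⟶ w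

  -- A packet is delivered as soon as it is at its destination, so a route must not pass through b
  -- before its end.
  Valid : V → V → List Move → Set
  Valid b v []       = v ≡ b
  Valid b v (m ∷ ms) = v ≢ b × Step v m × Valid b (fromMaybe v m) ms

  valid? : Decidable _⟶_ → ∀ b v ms → Dec (Valid b v ms)
  valid? _⟶?_ b v []            = v ≟ᵛ b
  valid? _⟶?_ b v (nothing ∷ ms) = ¬? (v ≟ᵛ b) ×-dec yes tt ×-dec valid? _⟶?_ b v ms
  valid? _⟶?_ b v (just w ∷ ms)  = ¬? (v ≟ᵛ b) ×-dec (v ⟶? w) ×-dec valid? _⟶?_ b w ms

  step-edges : ∀ {b u v} t x ms → Valid b x ms → ∀ {τ} → (u , just v , τ) ∈ edges t x ms → u ⟶ v
  step-edges t x (m ∷ ms) (_ , u⟶v , _) (here refl) = u⟶v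
  step-edges t x (m ∷ ms) (_ , _ , valid) (there e∈) = step-edges (suc t) (fromMaybe x m) ms valid e∈

  -- Every move takes one step, so the j-th edge of the route has time j + t. The bound n on the
  -- length is left free: it is `length ms` when the edges of a route are shown to be distinct, and
  -- the diameter for detours.
  count-edges : ∀ e t v ms {n} → length ms ≤ n →
                count _≟ᴱ_ e (edges t v ms) ≤ ∑ (λ j → ⟦ does (j + t ≟ time e) ⟧) (upTo n)
  count-edges e t v []       _ = z≤n
  count-edges e t v (m ∷ ms) {suc n} (s≤s ∣ms∣≤n) = begin
    ⟦ does (e ≟ᴱ (v , m , t)) ⟧ + count _≟ᴱ_ e (edges (suc t) (fromMaybe v m) ms)
      ≤⟨ +-mono-≤ (⟦⟧-≤ (e ≟ᴱ (v , m , t)) λ e≡ → ≤-reflexive (sym (⟦⟧-true (t ≟ time e) (sym (cong time e≡)))))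
                  (count-edges e (suc t) (fromMaybe v m) ms ∣ms∣≤n) ⟩
    ⟦ does (t ≟ time e) ⟧ + ∑ (λ j → ⟦ does (j + suc t ≟ time e) ⟧) (upTo n)
      ≡⟨ cong (⟦ does (t ≟ time e) ⟧ +_) (∑-cong (λ j → cong (λ y → ⟦ does (y ≟ time e) ⟧) (+-suc j t)) (upTo n)) ⟩
    ⟦ does (t ≟ time e) ⟧ + ∑ (λ j → ⟦ does (suc j + t ≟ time e) ⟧) (upTo n)
      ≡⟨ ∑-upTo (λ j → ⟦ does (j + t ≟ time e) ⟧) n ⟨
    ∑ (λ j → ⟦ does (j + t ≟ time e) ⟧) (upTo (suc n)) ∎
    where open ≤-Reasoning

  direct : List Move → List Move
  direct []             = []
  direct (nothing ∷ ms) = direct ms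
  direct (just w ∷ ms)  = just w ∷ direct ms

  direct-never-stores : ∀ {u τ} t v ms → count _≟ᴱ_ (u , nothing , τ) (edges t v (direct ms)) ≡ 0
  direct-never-stores t v []             = refl
  direct-never-stores t v (nothing ∷ ms) = direct-never-stores t v ms
  direct-never-stores {u} {τ} t v (just w ∷ ms) =
    cong₂ _+_ (⟦⟧-false ((u , nothing , τ) ≟ᴱ (v , just w , t)) λ ()) (direct-never-stores (suc t) w ms)

  -- A route with at most s moves is kept as it is, so every s yields a path, possibly a repeated
  -- one.
  depart : ℕ → List Move → List Move
  depart zero    ms       = direct ms
  depart (suc s) []       = []
  depart (suc s) (m ∷ ms) = m ∷ depart s ms

  direct-valid : ∀ {b} v ms → Valid b v ms → Valid b v (direct ms)
  direct-valid v []             valid               = valid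
  direct-valid v (nothing ∷ ms) (_ , _ , valid)     = direct-valid v ms valid
  direct-valid v (just w ∷ ms)  (v≢b , v⟶w , valid) = v≢b , v⟶w , direct-valid w ms valid

  depart-valid : ∀ {b} s v ms → Valid b v ms → Valid b v (depart s ms)
  depart-valid zero    v ms       valid                = direct-valid v ms valid
  depart-valid (suc s) v []       valid                = valid
  depart-valid (suc s) v (m ∷ ms) (v≢b , step , valid) = v≢b , step , depart-valid s (fromMaybe v m) ms valid

  direct-length : ∀ ms → length (direct ms) ≤ length ms
  direct-length []             = z≤n
  direct-length (nothing ∷ ms) = m≤n⇒m≤1+n (direct-length ms)
  direct-length (just w ∷ ms)  = s≤s (direct-length ms)

  -- Departing from a route never delays the packet, so the deadline is still met.
  depart-length : ∀ s ms → length (depart s ms) ≤ length ms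
  depart-length zero    ms       = direct-length ms
  depart-length (suc s) []       = z≤n
  depart-length (suc s) (m ∷ ms) = s≤s (depart-length s ms)

  direct-path : ∀ {b} v ms → Valid b v ms →
                ∃ λ (p : Star _⟶_ v b) → pathLength G p ≡ length (direct ms)
  direct-path v []             refl = ε , refl
  direct-path v (nothing ∷ ms) (_ , _ , valid) = direct-path v ms valid
  direct-path v (just w ∷ ms)  (_ , v⟶w , valid) with direct-path w ms valid
  ... | p , ∣p∣≡ = v⟶w ◅ p , cong suc ∣p∣≡

  module _ {D : ℕ} (∣path∣≤D : ∀ {u v} (p : Star _⟶_ u v) → pathLength G p ≤ D) where

    direct-length-≤ : ∀ {b} v ms → Valid b v ms → length (direct ms) ≤ D
    direct-length-≤ v ms valid with direct-path v ms valid
    ... | p , ∣p∣≡ = subst (_≤ D) ∣p∣≡ (∣path∣≤D p)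

    depart-length-≤ : ∀ {b} s v ms → Valid b v ms → length (depart s ms) ≤ s + D
    depart-length-≤ zero    v ms       valid           = direct-length-≤ v ms valid
    depart-length-≤ (suc s) v []       valid           = z≤n
    depart-length-≤ (suc s) v (m ∷ ms) (_ , _ , valid) = s≤s (depart-length-≤ s (fromMaybe v m) ms valid)

  -- Edges used by a schedule

  action : Move → Action
  action nothing  = store
  action (just w) = forward w

  usedEdge : ℕ → Status → Action → Maybe Edge
  usedEdge t (at v) (forward w) = just (v , just w , t)
  usedEdge t (at v) store       = just (v , nothing , t)
  usedEdge t (at v) delete      = nothing
  usedEdge t awaited       a    = nothing
  usedEdge t (delivered s) a    = nothing
  usedEdge t (deleted s)   a    = nothing

  usedEdge-at : ∀ t v m → usedEdge t (at v) (action m) ≡ just (v , m , t)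
  usedEdge-at t v nothing  = refl
  usedEdge-at t v (just w) = refl

  usedEdge⇒ : ∀ t x a {v m τ} → usedEdge t x a ≡ just (v , m , τ) → x ≡ at v × a ≡ action m × t ≡ τ
  usedEdge⇒ t (at v) (forward w) refl = refl , refl , refl
  usedEdge⇒ t (at v) store       refl = refl , refl , refl

  _≟ᵁ_ : DecidableEquality (Maybe Edge)
  _≟ᵁ_ = Maybe.≡-dec _≟ᴱ_

  module _ (r : Request) where

    arrive-destination : ∀ t {v} → v ≡ destination r → arrive r t v ≡ delivered t
    arrive-destination t {v} v≡b with v ≟ᵛ destination r
    ... | yes _   = refl
    ... | no  v≢b = contradiction v≡b v≢b

    arrive-elsewhere : ∀ t {v} → v ≢ destination r → arrive r t v ≡ at v
    arrive-elsewhere t {v} v≢b with v ≟ᵛ destination r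
    ... | yes v≡b = contradiction v≡b v≢b
    ... | no  _   = refl

  module _ (r : Request) (plan : ℕ → Action) where

    used : ℕ → Maybe Edge
    used t = usedEdge t (status r plan t) (plan t)

    -- A packet deleted in step t does not count, so the capacities bound the number of packets
    -- present although any number may be input.
    present : ℕ → ℕ
    present t = ⟦ is-just (used t) ⟧

    uses : Edge → ℕ
    uses e = ⟦ does (used (time e) ≟ᵁ just e) ⟧

    used⇒time : ∀ {t e} → used t ≡ just e → t ≡ time e
    used⇒time {t} used≡ = proj₂ (proj₂ (usedEdge⇒ t (status r plan t) (plan t) used≡))

    -- Staying at v can be treated as an arrival at v because v is not the destination.
    status-step : ∀ t m {v} → v ≢ destination r → status r plan t ≡ at v → plan t ≡ action m →
                  status r plan (suc t) ≡ arrive r (suc t) (fromMaybe v m)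
    status-step t nothing  v≢b at≡ plan≡ rewrite at≡ | plan≡ = sym (arrive-elsewhere r (suc t) v≢b)
    status-step t (just w) v≢b at≡ plan≡ rewrite at≡ | plan≡ = refl

    input-awaited : ∀ t → t ≢ inputTime r → input r t ≡ awaited
    input-awaited t t≢ =
      cong (if_then arrive r t (source r) else awaited) (dec-false (t ≟ inputTime r) t≢)

    input-arrives : input r (inputTime r) ≡ arrive r (inputTime r) (source r)
    input-arrives =
      cong (if_then arrive r (inputTime r) (source r) else awaited)
           (dec-true (inputTime r ≟ inputTime r) refl)

    awaited-before : ∀ t → t < inputTime r → status r plan t ≡ awaited
    awaited-before zero    t< = input-awaited zero (<⇒≢ t<)
    awaited-before (suc t) t< rewrite awaited-before t (<⇒≤ t<) = input-awaited (suc t) (<⇒≢ t<)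

    status-input : status r plan (inputTime r) ≡ arrive r (inputTime r) (source r)
    status-input = go (inputTime r) refl
      where
      go : ∀ t → t ≡ inputTime r → status r plan t ≡ arrive r t (source r)
      go zero    refl = input-arrives
      go (suc t) refl rewrite awaited-before t ≤-refl = input-arrives

    used⇒inputTime≤ : ∀ {t e} → used t ≡ just e → inputTime r ≤ t
    used⇒inputTime≤ {t} used≡ with inputTime r ≤? t
    ... | yes t₀≤t = t₀≤t
    ... | no  t₀≰t rewrite awaited-before t (≰⇒> t₀≰t) with () ← used≡

    delivered-stays : ∀ {s} t → status r plan t ≡ delivered s → ∀ f → status r plan (f + t) ≡ delivered s
    delivered-stays t eq zero    = eq
    delivered-stays t eq (suc f) rewrite delivered-stays t eq f = refl

    deleted-stays : ∀ {s} t → status r plan t ≡ deleted s → ∀ f → status r plan (f + t) ≡ deleted s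
    deleted-stays t eq zero    = eq
    deleted-stays t eq (suc f) rewrite deleted-stays t eq f = refl

    -- Ties a valid route to the edges that the plan really uses, up to delivery.
    data Trace : ℕ → V → List Move → Set where
      done : ∀ {t v} → v ≡ destination r → Trace t v []
      move : ∀ {t v m ms} → v ≢ destination r → used t ≡ just (v , m , t) → Step v m →
             Trace (suc t) (fromMaybe v m) ms → Trace t v (m ∷ ms)

    trace-valid : ∀ {t v ms} → Trace t v ms → Valid (destination r) v ms
    trace-valid (done v≡b)            = v≡b
    trace-valid (move v≢b _ step tr) = v≢b , step , trace-valid tr

    -- The edges of a route have distinct times, so e occurs at most once, and if it occurs, it is
    -- used.
    trace-count : ∀ {t v ms} e → Trace t v ms → count _≟ᴱ_ e (edges t v ms) ≤ uses e
    trace-count e (done _) = z≤n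
    trace-count {t} {v} {m ∷ ms} e (move _ used≡ _ tr) with e ≟ᴱ (v , m , t)
    ... | no  _    = trace-count e tr
    ... | yes refl = begin
      -- The rest of the route begins at time `suc t`, so it cannot return to e, whose time is t.
      suc (count _≟ᴱ_ e (edges (suc t) (fromMaybe v m) ms)) ≤⟨ s≤s (count-edges e (suc t) (fromMaybe v m) ms ≤-refl) ⟩
      suc (∑ (λ j → ⟦ does (j + suc t ≟ t) ⟧) (upTo (length ms))) ≤⟨ s≤s (∑-shifted (length ms) (suc t) t) ⟩
      suc ⟦ does (suc t ≤? t) ⟧                             ≡⟨ cong suc (⟦⟧-false (suc t ≤? t) (<-irrefl refl)) ⟩
      1                                                     ≡⟨ ⟦⟧-true (used t ≟ᵁ just e) used≡ ⟨
      uses e                                                ∎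
      where open ≤-Reasoning

    -- Induction on the number f of steps until a time at which the packet is known to have been
    -- delivered. This may be later than the delivery itself, which happens at time s.
    trace-follow : (∀ {t v w} → status r plan t ≡ at v → plan t ≡ forward w → v ⟶ w) →
                   ∀ f t v {s} → status r plan t ≡ arrive r t v → status r plan (f + t) ≡ delivered s →
                   ∃ λ ms → Trace t v ms × length ms + t ≡ s
    trace-follow along f t v arr del with v ≟ᵛ destination r
    ... | yes v≡b with refl ← trans (sym (delivered-stays t arr f)) del = [] , done v≡b , refl
    trace-follow along zero    t v arr del | no v≢b with () ← trans (sym arr) del
    trace-follow along (suc f) t v {s} arr del | no v≢b = go (plan t) refl
      where
      continue : ∀ m → plan t ≡ action m → Step v m → ∃ λ ms → Trace t v ms × length ms + t ≡ s
      continue m plan≡ step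
        with trace-follow along f (suc t) (fromMaybe v m) (status-step t m v≢b arr plan≡)
                          (subst (λ x → status r plan x ≡ delivered s) (sym (+-suc f t)) del)
      ... | ms , tr , len = m ∷ ms ,
          move v≢b (trans (cong₂ (usedEdge t) arr plan≡) (usedEdge-at t v m)) step tr ,
          trans (sym (+-suc (length ms) t)) len
      go : ∀ a → plan t ≡ a → ∃ λ ms → Trace t v ms × length ms + t ≡ s
      go (forward w) plan≡ = continue (just w) plan≡ (along arr plan≡)
      go store       plan≡ = continue nothing plan≡ tt
      go delete      plan≡
        with () ← trans (sym (deleted-stays (suc t) (cong₂ (next r t) plan≡ arr) f))
                        (subst (λ x → status r plan x ≡ delivered s) (sym (+-suc f t)) del)

    module _ {D : ℕ} (∣path∣≤D : ∀ {u v} (p : Star _⟶_ u v) → pathLength G p ≤ D) where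

      open ≤-Reasoning

      -- Bounds how often a detour beginning at time t crosses e: it makes at most D moves, one per
      -- step. The factor `present t` is there because nothing departs after delivery.
      detour : Edge → ℕ → ℕ
      detour e t = ∑ (λ j → ⟦ does (j + t ≟ time e) ⟧ * present t) (upTo D)

      -- An occurrence of e lies either on the part shared with the route or on the detour, which
      -- begins at time s + t and never stores, hence the factor `link e`.
      depart-count : ∀ {t v ms} e s → Trace t v ms →
                     count _≟ᴱ_ e (edges t v (depart s ms)) ≤
                     count _≟ᴱ_ e (edges t v ms) + link e * detour e (s + t)
      depart-count e zero    (done _) = z≤n
      depart-count e (suc s) (done _) = z≤n
      depart-count {t} {v} {ms} (u , nothing , τ) zero tr =
        ≤-trans (≤-reflexive (direct-never-stores t v ms)) z≤n
      depart-count {t} {v} {ms} e@(u , just w , τ) zero tr@(move _ used≡ _ _) = begin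
        count _≟ᴱ_ e (edges t v (direct ms))
          ≤⟨ count-edges e t v (direct ms) (direct-length-≤ ∣path∣≤D v ms (trace-valid tr)) ⟩
        ∑ (λ j → ⟦ does (j + t ≟ τ) ⟧) (upTo D)
          -- The route goes on with a move at time t, so the packet is present.
          ≡⟨ ∑-cong (λ j → trans (sym (*-identityʳ _))
                                 (cong (λ x → ⟦ does (j + t ≟ τ) ⟧ * ⟦ is-just x ⟧) (sym used≡))) (upTo D) ⟩
        detour e t
          ≡⟨ *-identityˡ (detour e t) ⟨
        1 * detour e t
          ≤⟨ m≤n+m (1 * detour e t) (count _≟ᴱ_ e (edges t v ms)) ⟩
        count _≟ᴱ_ e (edges t v ms) + 1 * detour e t ∎
      depart-count {t} {v} {m ∷ ms} e (suc s) (move _ _ _ tr) = begin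
        ⟦ does (e ≟ᴱ (v , m , t)) ⟧ + count _≟ᴱ_ e (edges (suc t) (fromMaybe v m) (depart s ms))
          ≤⟨ +-monoʳ-≤ ⟦ does (e ≟ᴱ (v , m , t)) ⟧ (depart-count e s tr) ⟩
        ⟦ does (e ≟ᴱ (v , m , t)) ⟧ + (count _≟ᴱ_ e (edges (suc t) (fromMaybe v m) ms) + link e * detour e (s + suc t))
          ≡⟨ +-assoc ⟦ does (e ≟ᴱ (v , m , t)) ⟧ _ _ ⟨
        count _≟ᴱ_ e (edges t v (m ∷ ms)) + link e * detour e (s + suc t)
          ≡⟨ cong (λ x → count _≟ᴱ_ e (edges t v (m ∷ ms)) + link e * detour e x) (+-suc s t) ⟩
        count _≟ᴱ_ e (edges t v (m ∷ ms)) + link e * detour e (suc s + t) ∎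

      -- The shared parts give at most `uses e` for each s. As for the detours, fix the number j of
      -- steps from the departure to the crossing of e: then the time of departure is `time e ∸ j`,
      -- which leaves at most one s.
      departures-count : ∀ {t v ms} e T → Trace t v ms →
                         ∑ (λ s → count _≟ᴱ_ e (edges t v (depart s ms))) (upTo T) ≤
                         T * uses e + link e * ∑ (λ j → present (time e ∸ j)) (upTo D)
      departures-count {t} {v} {ms} e T tr = begin
        ∑ (λ s → count _≟ᴱ_ e (edges t v (depart s ms))) (upTo T)
          ≤⟨ ∑-mono (λ s → ≤-trans (depart-count e s tr) (+-monoˡ-≤ _ (trace-count e tr))) (upTo T) ⟩
        ∑ (λ s → uses e + link e * detour e (s + t)) (upTo T)
          ≡⟨ ∑-+ _ _ (upTo T) ⟩
        ∑ (λ _ → uses e) (upTo T) + ∑ (λ s → link e * detour e (s + t)) (upTo T)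
          ≡⟨ cong₂ _+_ (trans (∑-const (uses e) (upTo T)) (cong (_* uses e) (length-upTo T)))
                       (trans (∑-*ˡ (link e) _ (upTo T)) (cong (link e *_) (∑-comm _ (upTo T) (upTo D)))) ⟩
        T * uses e + link e * ∑ (λ j → ∑ (λ s → ⟦ does (j + (s + t) ≟ time e) ⟧ * present (s + t)) (upTo T)) (upTo D)
          ≤⟨ +-monoʳ-≤ (T * uses e) (*-monoʳ-≤ (link e)
               (∑-mono (λ j → ∑-shifted-≤ present T t (time e) j) (upTo D))) ⟩
        T * uses e + link e * ∑ (λ j → present (time e ∸ j)) (upTo D) ∎

-- Schedules as loads on space-time edges

∑-mono-∈ : ∀ {X : Set} {f g : X → ℕ} xs → (∀ {x} → x ∈ xs → f x ≤ g x) → ∑ f xs ≤ ∑ g xs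
∑-mono-∈ []       f≤g = z≤n
∑-mono-∈ (x ∷ xs) f≤g = +-mono-≤ (f≤g (here refl)) (∑-mono-∈ xs (f≤g ∘ there))

AtMost-∑ : ∀ {m n} {P : Fin m → Set} (f : Fin m → ℕ) → (∀ i → P i → 1 ≤ f i) →
           ∑ f (allFin m) ≤ n → AtMost n P
AtMost-∑ {m} {n} f P⇒1≤f ∑f≤n X X⊆P = begin
  ∣ X ∣                               ≡⟨ ∣∣≡∑ X ⟩
  ∑ (⟦_⟧ ∘ Vec.lookup X) (allFin m)   ≤⟨ ∑-mono (λ i → bound i (Vec.lookup X i) refl) (allFin m) ⟩
  ∑ f (allFin m)                      ≤⟨ ∑f≤n ⟩
  n                                   ∎
  where
  open ≤-Reasoning
  bound : ∀ i b → Vec.lookup X i ≡ b → ⟦ b ⟧ ≤ f i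
  bound i false _  = z≤n
  bound i true  eq = P⇒1≤f i (X⊆P i (Vec.lookup⇒[]= i X eq))

∣tabulate∣ : ∀ {m} (f : Fin m → Bool) → ∣ Vec.tabulate f ∣ ≡ ∑ (⟦_⟧ ∘ f) (allFin m)
∣tabulate∣ {m} f = trans (∣∣≡∑ (Vec.tabulate f)) (∑-cong (λ i → cong ⟦_⟧ (Vec.lookup∘tabulate f i)) (allFin m))

∈-tabulate : ∀ {m} (f : Fin m → Bool) i → i Subset.∈ Vec.tabulate f ⇔ (f i ≡ true)
∈-tabulate f i = mk⇔ (λ i∈ → trans (sym (Vec.lookup∘tabulate f i)) (Vec.[]=⇒lookup i∈))
                     (λ fi → Vec.lookup⇒[]= i _ (trans (Vec.lookup∘tabulate f i) fi))

-- The bound is applied to the largest subset possible, that of all i with `P i`.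
∑-AtMost : ∀ {m n} {P : Fin m → Set} (P? : Unary.Decidable P) → AtMost n P →
           ∑ (λ i → ⟦ does (P? i) ⟧) (allFin m) ≤ n
∑-AtMost P? atMost = subst (_≤ _) (∣tabulate∣ (does ∘ P?)) $
  atMost _ λ i i∈ → does⇒ (P? i) (Equivalence.to (∈-tabulate (does ∘ P?) i) i∈)
  where
  does⇒ : ∀ {A : Set} (A? : Dec A) → does A? ≡ true → A
  does⇒ (yes a) _ = a

module _ {X : Set} {Q : X → Set} where

  pick : ∀ {xs} → Dec (Any Q xs) → Maybe X
  pick (yes any) = just (proj₁ (Any.satisfied any))
  pick (no  _)   = nothing

  pick-just : ∀ {xs x} (any? : Dec (Any Q xs)) → pick any? ≡ just x → Q x
  pick-just (yes any) refl = proj₂ (Any.satisfied any)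

  pick-nothing : ∀ {xs} (any? : Dec (Any Q xs)) → pick any? ≡ nothing → ¬ Any Q xs
  pick-nothing (no ¬any) _ = ¬any

-- A finite search space for routes.
words : {X : Set} → List X → ℕ → List (List X)
words xs zero    = [] ∷ []
words xs (suc n) = [] ∷ cartesianProductWith _∷_ xs (words xs n)

∈-words : ∀ {X : Set} {xs : List X} → (∀ x → x ∈ xs) → ∀ n w → length w ≤ n → w ∈ words xs n
∈-words all zero    []      _         = here refl
∈-words all (suc n) []      _         = here refl
∈-words all (suc n) (x ∷ w) (s≤s ∣w∣≤n) = there (∈-cartesianProductWith⁺ _∷_ (all x) (∈-words all n w ∣w∣≤n))

module Schedules (G : Digraph) (Admissible : Digraph.V G → Digraph.V G → Set) (c B : ℕ) where

  open Digraph G using (V; _⟶_)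
  open Routing G Admissible c B
  open SpaceTime G Admissible c B

  module _ (σ : Input) (S : Schedule σ) where

    usesBy : Packet σ → Edge → ℕ
    usesBy i = uses (req σ i) (S i)

    presentBy : Packet σ → ℕ → ℕ
    presentBy i = present (req σ i) (S i)

    packets : List (Packet σ)
    packets = allFin _

    forwarded⇒used : ∀ {u v t i} → Forwarded σ S u v t i → used (req σ i) (S i) t ≡ just (u , just v , t)
    forwarded⇒used {t = t} (at≡ , plan≡) = cong₂ (usedEdge t) at≡ plan≡

    stored⇒used : ∀ {v t i} → Stored σ S v t i → used (req σ i) (S i) t ≡ just (v , nothing , t)
    stored⇒used {t = t} (at≡ , plan≡) = cong₂ (usedEdge t) at≡ plan≡

    used⇒uses : ∀ {i} e → used (req σ i) (S i) (time e) ≡ just e → 1 ≤ usesBy i e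
    used⇒uses {i} e used≡ = ≤-reflexive (sym (⟦⟧-true (used (req σ i) (S i) (time e) ≟ᵁ just e) used≡))

    uses≤capacity : Feasible σ S → ∀ e → ∑ (λ i → usesBy i e) packets ≤ capacity e
    uses≤capacity feasible e@(v , m , t) =
      ∑-AtMost (λ i → used (req σ i) (S i) t ≟ᵁ just e) (bound m)
      where
      open Feasible feasible
      bound : ∀ m → AtMost (capacity (v , m , t)) (λ i → used (req σ i) (S i) t ≡ just (v , m , t))
      bound nothing  X X⊆ = bufferSize v t X λ i i∈ →
        let at≡ , plan≡ , _ = usedEdge⇒ t _ (S i t) (X⊆ i i∈) in at≡ , plan≡
      bound (just w) X X⊆ = linkCapacity v w t X λ i i∈ →
        let at≡ , plan≡ , _ = usedEdge⇒ t _ (S i t) (X⊆ i i∈) in at≡ , plan≡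

    uses⇒feasible : (∀ u v t i → used (req σ i) (S i) t ≡ just (u , just v , t) → u ⟶ v) →
                    (∀ e → ∑ (λ i → usesBy i e) packets ≤ capacity e) → Feasible σ S
    uses⇒feasible along bounded = record
      { alongEdges   = λ u v t i fwd → along u v t i (forwarded⇒used fwd)
      ; linkCapacity = λ u v t → AtMost-∑ (λ i → usesBy i (u , just v , t))
                                          (λ i fwd → used⇒uses (u , just v , t) (forwarded⇒used fwd))
                                          (bounded (u , just v , t))
      ; bufferSize   = λ v t → AtMost-∑ (λ i → usesBy i (v , nothing , t))
                                        (λ i str → used⇒uses (v , nothing , t) (stored⇒used str))
                                        (bounded (v , nothing , t))
      }

    -- Nothing is delivered before its input time, so the packet can be followed from there.
    delivered⇒trace : Feasible σ S → ∀ i s → DeliveredAt σ S s i →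
                      ∃ λ ms → Trace (req σ i) (S i) (inputTime (req σ i)) (source (req σ i)) ms ×
                               length ms + inputTime (req σ i) ≡ s
    delivered⇒trace feasible i s (t , del) with inputTime (req σ i) ≤? t
    ... | no  t₀≰t with () ← trans (sym (awaited-before (req σ i) (S i) t (≰⇒> t₀≰t))) del
    ... | yes t₀≤t = trace-follow r plan (λ {u} {v} {w} at≡ plan≡ → Feasible.alongEdges feasible v w _ i (at≡ , plan≡))
                       (t ∸ inputTime r) (inputTime r) (source r) (status-input r plan)
                       (subst (λ x → status r plan x ≡ delivered s) (sym (m∸n+n≡m t₀≤t)) del)
      where
      r = req σ i
      plan = S i

  module _ {vertices : List V} (∈vertices : ∀ v → v ∈ vertices)
           {neighbours : V → List V} (∈neighbours : ∀ {u v} → u ⟶ v → v ∈ neighbours u)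
           {d : ℕ} (degree≤d : ∀ v → length (neighbours v) ≤ d)
           (σ : Input) (S : Schedule σ) (feasible : Feasible σ S) where

    open ≤-Reasoning

    -- A present packet uses an edge at time t, which is the buffer edge of a vertex or, by
    -- feasibility, leads to one of its neighbours. This reduces presence to capacities.
    present≤uses : ∀ t i → presentBy σ S i t ≤
                   ∑ (λ v → usesBy σ S i (v , nothing , t) +
                            ∑ (λ w → usesBy σ S i (v , just w , t)) (neighbours v)) vertices
    present≤uses t i = go (used r plan t) refl
      where
      r = req σ i
      plan = S i
      total : V → ℕ
      total v = usesBy σ S i (v , nothing , t) + ∑ (λ w → usesBy σ S i (v , just w , t)) (neighbours v)
      go : ∀ u → used r plan t ≡ u → ⟦ is-just u ⟧ ≤ ∑ total vertices
      go nothing used≡ = z≤n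
      go (just (v , m , τ)) used≡ with refl ← used⇒time r plan used≡ =
        ≤-trans (local m used≡) (∑-∈ total (∈vertices v))
        where
        local : ∀ m → used r plan t ≡ just (v , m , t) → 1 ≤ total v
        local nothing  used≡ = ≤-trans (used⇒uses σ S (v , nothing , t) used≡) (m≤m+n _ _)
        local (just w) used≡ = ≤-trans (used⇒uses σ S (v , just w , t) used≡)
          (≤-trans (∑-∈ (λ w → usesBy σ S i (v , just w , t)) (∈neighbours v⟶w)) (m≤n+m _ _))
          where
          v⟶w : v ⟶ w
          v⟶w = let at≡ , plan≡ , _ = usedEdge⇒ t _ (plan t) used≡
                in Feasible.alongEdges feasible v w t i (at≡ , plan≡)

    ∑-present : ∀ t → ∑ (λ i → presentBy σ S i t) (packets σ S) ≤ length vertices * (B + d * c)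
    ∑-present t = begin
      ∑ (λ i → presentBy σ S i t) ps
        ≤⟨ ∑-mono (present≤uses t) ps ⟩
      ∑ (λ i → ∑ (λ v → usesBy σ S i (v , nothing , t) + ∑ (λ w → usesBy σ S i (v , just w , t)) (neighbours v)) vertices) ps
        ≡⟨ ∑-comm _ ps vertices ⟩
      ∑ (λ v → ∑ (λ i → usesBy σ S i (v , nothing , t) + ∑ (λ w → usesBy σ S i (v , just w , t)) (neighbours v)) ps) vertices
        ≤⟨ ∑-mono perVertex vertices ⟩
      ∑ (λ v → B + d * c) vertices
        ≡⟨ ∑-const (B + d * c) vertices ⟩
      length vertices * (B + d * c) ∎
      where
      ps = packets σ S
      perVertex : ∀ v → ∑ (λ i → usesBy σ S i (v , nothing , t) + ∑ (λ w → usesBy σ S i (v , just w , t)) (neighbours v)) ps ≤ B + d * c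
      perVertex v = begin
        ∑ (λ i → usesBy σ S i (v , nothing , t) + ∑ (λ w → usesBy σ S i (v , just w , t)) (neighbours v)) ps
          ≡⟨ ∑-+ _ _ ps ⟩
        ∑ (λ i → usesBy σ S i (v , nothing , t)) ps + ∑ (λ i → ∑ (λ w → usesBy σ S i (v , just w , t)) (neighbours v)) ps
          ≡⟨ cong (∑ (λ i → usesBy σ S i (v , nothing , t)) ps +_) (∑-comm _ ps (neighbours v)) ⟩
        ∑ (λ i → usesBy σ S i (v , nothing , t)) ps + ∑ (λ w → ∑ (λ i → usesBy σ S i (v , just w , t)) ps) (neighbours v)
          ≤⟨ +-mono-≤ (uses≤capacity σ S feasible (v , nothing , t))
                      (∑-mono (λ w → uses≤capacity σ S feasible (v , just w , t)) (neighbours v)) ⟩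
        B + ∑ (λ _ → c) (neighbours v)
          ≡⟨ cong (B +_) (∑-const c (neighbours v)) ⟩
        B + length (neighbours v) * c
          ≤⟨ +-monoʳ-≤ B (*-monoˡ-≤ c (degree≤d v)) ⟩
        B + d * c ∎

-- The online algorithm

module Online (G : Digraph) (Admissible : Digraph.V G → Digraph.V G → Set) (c B : ℕ)
              (_⟶?_ : Decidable (Digraph._⟶_ G))
              (vertices : List (Digraph.V G)) (∈vertices : ∀ v → v ∈ vertices)
              (k : ℕ) {{_ : NonZero k}} (k≤c : k ≤ c) (k≤B : k ≤ B) (P : ℕ) where

  open Digraph G using (V; _⟶_)
  open Routing G Admissible c B
  open SpaceTime G Admissible c B
  open Schedules G Admissible c B

  k≤capacity : ∀ e → k ≤ capacity e
  k≤capacity (_ , nothing , _) = k≤B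
  k≤capacity (_ , just _  , _) = k≤c

  q : Edge → ℕ
  q e = capacity e / k

  instance
    q-nonZero : ∀ {e} → NonZero (q e)
    q-nonZero {e} = >-nonZero (m≥n⇒m/n>0 (k≤capacity e))

  open Greedy _≟ᴱ_ q k

  k*q≤capacity : ∀ e → k * q e ≤ capacity e
  k*q≤capacity e = ≤-trans (≤-reflexive (*-comm k (q e))) (m/n*n≤m (capacity e) k)

  -- Rounding the capacity down to a multiple of k loses less than k, and at least one multiple is
  -- left, so no more than half is lost.
  capacity≤2*k*q : ∀ e → capacity e ≤ 2 * k * q e
  capacity≤2*k*q e = begin
    capacity e                        ≡⟨ m≡m%n+[m/n]*n (capacity e) k ⟩
    capacity e % k + q e * k          ≤⟨ +-monoˡ-≤ (q e * k) (<⇒≤ (m%n<n (capacity e) k)) ⟩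
    k + q e * k                       ≤⟨ +-monoˡ-≤ (q e * k) (m≤n*m k (q e)) ⟩
    q e * k + q e * k                 ≡⟨ double (q e) k ⟩
    2 * k * q e                       ∎
    where
    open ≤-Reasoning
    double : ∀ q k → q * k + q * k ≡ 2 * k * q
    double = solve-∀

  path : Request → List Move → List Edge
  path r = edges (inputTime r) (source r)

  OnTime : Request → List Move → Set
  OnTime r ms = Maybe.All (length ms + inputTime r ≤_) (deadline r)

  Route : Request → List Move → Set
  Route r ms = Valid (destination r) (source r) ms × OnTime r ms

  Good : List (List Edge) → Request → List Move → Set
  Good A r ms = Route r ms × cost A (path r ms) < 2 ^ k

  good? : ∀ A r → Unary.Decidable (Good A r)
  good? A r ms = (valid? _⟶?_ (destination r) (source r) ms ×-dec Maybe.dec (_ ≤?_) (deadline r))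
                 ×-dec (cost A (path r ms) <? 2 ^ k)

  moves : List Move
  moves = nothing ∷ map just vertices

  ∈moves : ∀ m → m ∈ moves
  ∈moves nothing  = here refl
  ∈moves (just v) = there (∈-map⁺ just (∈vertices v))

  goodWord? : ∀ A r → Dec (Any (Good A r) (words moves P))
  goodWord? A r = Any.any? (good? A r) (words moves P)

  choose : List (List Edge) → Request → Maybe (List Move)
  choose A r = pick (goodWord? A r)

  choose-just : ∀ A r {ms} → choose A r ≡ just ms → Good A r ms
  choose-just A r = pick-just (goodWord? A r)

  choose-nothing : ∀ A r → choose A r ≡ nothing → ∀ ms → length ms ≤ P → Route r ms →
                   2 ^ k ≤ cost A (path r ms)
  choose-nothing A r eq ms ∣ms∣≤P route = ≮⇒≥ λ cheap →
    pick-nothing (goodWord? A r) eq (lose (∈-words ∈moves P ms ∣ms∣≤P) (route , cheap))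

  admit : List (List Edge) → Request → Maybe (List Move) → List (List Edge)
  admit A r (just ms) = path r ms ∷ A
  admit A r nothing   = A

  extend : List (List Edge) → Request → List (List Edge)
  extend A r = admit A r (choose A r)

  final : List (List Edge) → List Request → List (List Edge)
  final = foldl extend

  decide : (A : List (List Edge)) (rs : List Request) → Fin (length rs) → Maybe (List Move)
  decide A (r ∷ rs) zero    = choose A r
  decide A (r ∷ rs) (suc i) = decide (extend A r) rs i

  -- A rejected packet is deleted in the step of its arrival. After the end of a route, `delete` is
  -- a dummy without effect, since the packet has been delivered.
  play : Maybe (List Move) → ℕ → Action
  play nothing         _       = delete
  play (just [])       _       = delete
  play (just (m ∷ ms)) zero    = action m
  play (just (m ∷ ms)) (suc j) = play (just ms) j

  -- Keeps no state: in every step all earlier admissions are replayed from the list of known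
  -- requests.
  perform : List (List Edge) → ℕ → List Request → ℕ → Action
  perform A t []       i       = delete
  perform A t (r ∷ rs) zero    = play (choose A r) (t ∸ inputTime r)
  perform A t (r ∷ rs) (suc i) = perform (extend A r) t rs i

  algorithm : OnlineAlgorithm
  algorithm = perform []

  -- By sortedness, the requests before a known one are known as well, and its decision depends on
  -- these only. Hence the replay at time t agrees with the decisions made on the whole input.
  perform-known : ∀ A t rs → AllPairs (λ r s → inputTime r ≤ inputTime s) rs →
                  ∀ i → inputTime (lookup rs i) ≤ t →
                  perform A t (filter (λ r → inputTime r ≤? t) rs) (toℕ i) ≡
                  play (decide A rs i) (t ∸ inputTime (lookup rs i))
  perform-known A t (r ∷ rs) (r≤ AllPairs.∷ sorted) zero t₀≤t
    rewrite filter-accept (λ r → inputTime r ≤? t) {x = r} {xs = rs} t₀≤t = refl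
  perform-known A t (r ∷ rs) (r≤ AllPairs.∷ sorted) (suc i) t₀≤t
    rewrite filter-accept (λ r → inputTime r ≤? t) {x = r} {xs = rs}
                          (≤-trans (All.lookup r≤ (∈-lookup i)) t₀≤t)
    = perform-known (extend A r) t rs sorted i t₀≤t

  extend-affordable : ∀ {A} r → Affordable A → Affordable (extend A r)
  extend-affordable {A} r aff = go (choose A r) refl
    where
    go : ∀ x → choose A r ≡ x → Affordable (admit A r x)
    go nothing   _  = aff
    go (just ms) eq = proj₂ (choose-just A r eq) ∷ aff

  final-affordable : ∀ {A} rs → Affordable A → Affordable (final A rs)
  final-affordable []       aff = aff
  final-affordable (r ∷ rs) aff = final-affordable rs (extend-affordable r aff)

  carries : Request → Maybe (List Move) → Edge → ℕ
  carries r nothing   e = 0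
  carries r (just ms) e = ⟦ does (e ∈? path r ms) ⟧

  load-admit : ∀ A r x e → load (admit A r x) e ≡ carries r x e + load A e
  load-admit A r nothing   e = refl
  load-admit A r (just ms) e = refl

  -- Passes from sums over packets to loads of accepted paths. The initial list A is arbitrary for
  -- the sake of the induction.
  load-final : ∀ A rs e → ∑ (λ i → carries (lookup rs i) (decide A rs i) e) (allFin _) + load A e ≡
                          load (final A rs) e
  load-final A []       e = refl
  load-final A (r ∷ rs) e = begin
    ∑ (λ i → carries (lookup (r ∷ rs) i) (decide A (r ∷ rs) i) e) (allFin _) + load A e
      ≡⟨ cong (_+ load A e) (∑-allFin λ i → carries (lookup (r ∷ rs) i) (decide A (r ∷ rs) i) e) ⟩
    carries r (choose A r) e + later + load A e
      ≡⟨ regroup (carries r (choose A r) e) later (load A e) ⟩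
    later + (carries r (choose A r) e + load A e)
      ≡⟨ cong (later +_) (load-admit A r (choose A r) e) ⟨
    later + load (extend A r) e
      ≡⟨ load-final (extend A r) rs e ⟩
    load (final A (r ∷ rs)) e ∎
    where
    open ≡-Reasoning
    later = ∑ (λ i → carries (lookup rs i) (decide (extend A r) rs i) e) (allFin _)
    regroup : ∀ a b c → a + b + c ≡ b + (a + c)
    regroup = solve-∀

  load≤load-final : ∀ A rs e → load A e ≤ load (final A rs) e
  load≤load-final A rs e = ≤-trans (m≤n+m _ _) (≤-reflexive (load-final A rs e))

  length-admit : ∀ A r x → length (admit A r x) ≡ ⟦ is-just x ⟧ + length A
  length-admit A r nothing   = refl
  length-admit A r (just ms) = refl

  length-final : ∀ A rs → ∑ (λ i → ⟦ is-just (decide A rs i) ⟧) (allFin _) + length A ≡ length (final A rs)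
  length-final A []       = refl
  length-final A (r ∷ rs) = begin
    ∑ (λ i → ⟦ is-just (decide A (r ∷ rs) i) ⟧) (allFin _) + length A
      ≡⟨ cong (_+ length A) (∑-allFin λ i → ⟦ is-just (decide A (r ∷ rs) i) ⟧) ⟩
    ⟦ is-just (choose A r) ⟧ + later + length A
      ≡⟨ regroup ⟦ is-just (choose A r) ⟧ later (length A) ⟩
    later + (⟦ is-just (choose A r) ⟧ + length A)
      ≡⟨ cong (later +_) (length-admit A r (choose A r)) ⟨
    later + length (extend A r)
      ≡⟨ length-final (extend A r) rs ⟩
    length (final A (r ∷ rs)) ∎
    where
    open ≡-Reasoning
    later = ∑ (λ i → ⟦ is-just (decide (extend A r) rs i) ⟧) (allFin _)
    regroup : ∀ a b c → a + b + c ≡ b + (a + c)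
    regroup = solve-∀

  decide-just : ∀ A rs i {ms} → decide A rs i ≡ just ms → Route (lookup rs i) ms
  decide-just A (r ∷ rs) zero    eq = proj₁ (choose-just A r eq)
  decide-just A (r ∷ rs) (suc i) eq = decide-just (extend A r) rs i eq

  -- Loads only grow, so a route that was too expensive when its request came is too expensive for
  -- the final weights.
  decide-nothing : ∀ A rs i → decide A rs i ≡ nothing → ∀ ms → length ms ≤ P → Route (lookup rs i) ms →
                   2 ^ k ≤ cost (final A rs) (path (lookup rs i) ms)
  decide-nothing A (r ∷ rs) zero eq ms ∣ms∣≤P route = ≤-trans
    (choose-nothing A r eq ms ∣ms∣≤P route)
    (∑-mono (λ e → weight-mono {A} {final A (r ∷ rs)} e (load≤load-final A (r ∷ rs) e)) (path r ms))
  decide-nothing A (r ∷ rs) (suc i) eq = decide-nothing (extend A r) rs i eq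

  -- The empty route costs nothing, so it is only ever turned down for
  -- missing the deadline.
  decide-nothing⇒nonempty : ∀ A rs i → decide A rs i ≡ nothing → ¬ Route (lookup rs i) []
  decide-nothing⇒nonempty A (r ∷ rs) zero    eq route = <⇒≱ (m^n>0 2 k) (choose-nothing A r eq [] z≤n route)
  decide-nothing⇒nonempty A (r ∷ rs) (suc i) eq = decide-nothing⇒nonempty (extend A r) rs i eq

  module _ (r : Request) (plan : ℕ → Action) where

    -- The packet follows its route move by move; once delivered, it uses no edge any more.
    follow : ∀ ms t v → Valid (destination r) v ms → status r plan t ≡ arrive r t v →
             (∀ j → plan (j + t) ≡ play (just ms) j) →
             status r plan (length ms + t) ≡ delivered (length ms + t) ×
             (∀ τ e → t ≤ τ → used r plan τ ≡ just e → e ∈ edges t v ms)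
    follow [] t v v≡b arr plays = del , λ τ e t≤τ used≡ →
        contradiction (trans (sym (cong (λ x → usedEdge τ x (plan τ)) (stays τ t≤τ))) used≡) λ ()
      where
      del = trans arr (arrive-destination r t v≡b)
      stays : ∀ τ → t ≤ τ → status r plan τ ≡ delivered t
      stays τ t≤τ = subst (λ x → status r plan x ≡ delivered t) (m∸n+n≡m t≤τ) (delivered-stays r plan t del (τ ∸ t))
    follow (m ∷ ms) t v (v≢b , step , valid) arr plays
      with follow ms (suc t) (fromMaybe v m) valid
             (status-step r plan t m v≢b at≡ (plays 0))
             (λ j → trans (cong plan (+-suc j t)) (plays (suc j)))
      where
      at≡ = trans arr (arrive-elsewhere r t v≢b)
    ... | del , later = subst (λ x → status r plan x ≡ delivered x) (+-suc (length ms) t) del , on-path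
      where
      at≡ = trans arr (arrive-elsewhere r t v≢b)
      on-path : ∀ τ e → t ≤ τ → used r plan τ ≡ just e → e ∈ edges t v (m ∷ ms)
      on-path τ e t≤τ used≡ with m≤n⇒m<n∨m≡n t≤τ
      ... | inj₁ t<τ  = there (later τ e t<τ used≡)
      ... | inj₂ refl = here (just-injective (trans (sym used≡)
                          (trans (cong₂ (usedEdge t) at≡ (plays 0)) (usedEdge-at t v m))))

  module _ (σ : Input) where

    S : Schedule σ
    S = run algorithm σ

    decision : Packet σ → Maybe (List Move)
    decision = decide [] (requests σ)

    accepted : List (List Edge)
    accepted = final [] (requests σ)

    S-plays : ∀ i {t} → inputTime (req σ i) ≤ t → S i t ≡ play (decision i) (t ∸ inputTime (req σ i))
    S-plays i {t} = perform-known [] t (requests σ) (sorted σ) i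

    accepted-follow : ∀ i {ms} → decision i ≡ just ms →
      let t₀ = inputTime (req σ i) in
      statusOf σ S i (length ms + t₀) ≡ delivered (length ms + t₀) ×
      (∀ τ e → t₀ ≤ τ → used (req σ i) (S i) τ ≡ just e → e ∈ path (req σ i) ms)
    accepted-follow i {ms} eq =
      follow (req σ i) (S i) ms t₀ (source (req σ i)) (proj₁ (decide-just [] (requests σ) i eq))
             (status-input (req σ i) (S i))
             (λ j → trans (S-plays i (m≤n+m t₀ j)) (cong₂ play eq (m+n∸n≡m j t₀)))
      where t₀ = inputTime (req σ i)

    rejected-idle : ∀ i → decision i ≡ nothing → ∀ τ e → ¬ (used (req σ i) (S i) τ ≡ just e)
    rejected-idle i eq τ (v , m , t) used≡ = action≢delete m
      (trans (sym (proj₁ (proj₂ (usedEdge⇒ τ _ (S i τ) used≡))))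
             (trans (S-plays i (used⇒inputTime≤ (req σ i) (S i) used≡)) (cong (λ x → play x _) eq)))
      where
      action≢delete : ∀ m → action m ≢ delete
      action≢delete nothing  ()
      action≢delete (just w) ()

    used⇒accepted : ∀ i {τ e} → used (req σ i) (S i) τ ≡ just e →
                    ∃ λ ms → decision i ≡ just ms × e ∈ path (req σ i) ms
    used⇒accepted i {τ} {e} used≡ = go (decision i) refl
      where
      go : ∀ x → decision i ≡ x → ∃ λ ms → decision i ≡ just ms × e ∈ path (req σ i) ms
      go nothing   eq = contradiction used≡ (rejected-idle i eq τ e)
      go (just ms) eq = ms , eq , proj₂ (accepted-follow i eq) τ e (used⇒inputTime≤ (req σ i) (S i) used≡) used≡

    feasible : Feasible σ S
    feasible = uses⇒feasible σ S along bounded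
      where
      along : ∀ u v t i → used (req σ i) (S i) t ≡ just (u , just v , t) → u ⟶ v
      along u v t i used≡ with used⇒accepted i used≡
      ... | ms , eq , e∈ = step-edges _ _ ms (proj₁ (decide-just [] (requests σ) i eq)) e∈
      uses≤carries : ∀ e i → usesBy σ S i e ≤ carries (req σ i) (decision i) e
      uses≤carries e i = ⟦⟧-≤ (used (req σ i) (S i) (time e) ≟ᵁ just e) λ used≡ →
        let ms , eq , e∈ = used⇒accepted i used≡ in
        ≤-reflexive (sym (trans (cong (λ x → carries (req σ i) x e) eq) (⟦⟧-true (e ∈? path (req σ i) ms) e∈)))
      bounded : ∀ e → ∑ (λ i → usesBy σ S i e) (packets σ S) ≤ capacity e
      bounded e = begin
        ∑ (λ i → usesBy σ S i e) (packets σ S)                      ≤⟨ ∑-mono (uses≤carries e) (packets σ S) ⟩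
        ∑ (λ i → carries (req σ i) (decision i) e) (packets σ S)    ≤⟨ m≤m+n _ 0 ⟩
        ∑ (λ i → carries (req σ i) (decision i) e) (packets σ S) + 0 ≡⟨ load-final [] (requests σ) e ⟩
        load accepted e                                             ≤⟨ load≤k*q (final-affordable (requests σ) []) e ⟩
        k * q e                                                     ≤⟨ k*q≤capacity e ⟩
        capacity e                                                  ∎
        where open ≤-Reasoning

    nonPreemptive : ∀ i → Rejected σ S i ⊎ Delivered σ S i
    nonPreemptive i = go (decision i) refl
      where
      r = req σ i
      t₀ = inputTime r
      go : ∀ x → decision i ≡ x → Rejected σ S i ⊎ Delivered σ S i
      go (just ms) eq = inj₂ (length ms + t₀ , length ms + t₀ , proj₁ (accepted-follow i eq))
      go nothing   eq = arrived (Digraph._≟_ G (source r) (destination r))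
        where
        arrived : Dec (source r ≡ destination r) → Rejected σ S i ⊎ Delivered σ S i
        -- Input at its destination, the packet is delivered at once, even if too late, so its
        -- deletion never takes effect.
        arrived (yes a≡b) = inj₂ (t₀ , t₀ , trans (status-input r (S i)) (arrive-destination r t₀ a≡b))
        -- The deletion in step t₀ shows in the status from `suc t₀` on.
        arrived (no  a≢b) = inj₁ (suc t₀ , cong₂ (next r t₀) (trans (S-plays i ≤-refl) (cong (λ x → play x _) eq))
                                            (trans (status-input r (S i)) (arrive-elsewhere r t₀ a≢b)))

    -- A rejected packet uses no edge, so its trace is empty; but if the empty route were on time,
    -- it would have been accepted.
    deliveredOnTime⇒accepted : ∀ i → DeliveredOnTime σ S i → is-just (decision i) ≡ true
    deliveredOnTime⇒accepted i (s , del , s≤deadline) = go (decision i) refl (delivered⇒trace σ S feasible i s del)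
      where
      r = req σ i
      go : ∀ x → decision i ≡ x → (∃ λ ms → Trace r (S i) (inputTime r) (source r) ms × length ms + inputTime r ≡ s) →
           is-just x ≡ true
      go (just _) _  _                          = refl
      go nothing  eq ([] , tr , refl)           = contradiction (trace-valid r (S i) tr , s≤deadline)
                                                                (decide-nothing⇒nonempty [] (requests σ) i eq)
      go nothing  eq (_ ∷ _ , move _ used≡ _ _ , _) = contradiction used≡ (rejected-idle i eq _ _)

    accepted⇒deliveredOnTime : ∀ i → is-just (decision i) ≡ true → DeliveredOnTime σ S i
    accepted⇒deliveredOnTime i = go (decision i) refl
      where
      go : ∀ x → decision i ≡ x → is-just x ≡ true → DeliveredOnTime σ S i
      go (just ms) eq _ = length ms + inputTime (req σ i) ,
                          (length ms + inputTime (req σ i) , proj₁ (accepted-follow i eq)) ,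
                          proj₂ (decide-just [] (requests σ) i eq)

    throughput : Throughput σ S (length accepted)
    throughput = Vec.tabulate (is-just ∘ decision) ,
      (λ i → mk⇔ (accepted⇒deliveredOnTime i ∘ Equivalence.to (∈-tabulate (is-just ∘ decision) i))
                 (Equivalence.from (∈-tabulate (is-just ∘ decision) i) ∘ deliveredOnTime⇒accepted i)) ,
      trans (∣tabulate∣ (is-just ∘ decision))
            (trans (sym (+-identityʳ _)) (length-final [] (requests σ)))

  -- Competitive ratio

  module _ {neighbours : V → List V} (∈neighbours : ∀ {u v} → u ⟶ v → v ∈ neighbours u)
           {d : ℕ} (degree≤d : ∀ v → length (neighbours v) ≤ d)
           {D : ℕ} (∣path∣≤D : ∀ {u v} (p : Star _⟶_ u v) → pathLength G p ≤ D)
           (T : ℕ) {{_ : NonZero T}} (T+D≤P : T + D ≤ P) (2*P≤2^k : 2 * P ≤ 2 ^ k)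
           (detours≤ : D * (length vertices * (B + d * c)) ≤ T * c)
           (σ : Input) where

    open ≤-Reasoning

    -- The part of the final weight that is due to load, as an unloaded edge has weight 1.
    excess : Edge → ℕ
    excess e = weight (accepted σ) e ∸ 1

    cost≡excess+length : ∀ p → cost (accepted σ) p ≡ ∑ excess p + length p
    cost≡excess+length p = begin-equality
      cost (accepted σ) p                   ≡⟨ ∑-cong (λ e → m∸n+n≡m (1≤weight (accepted σ) e)) p ⟨
      ∑ (λ e → excess e + 1) p              ≡⟨ ∑-+ excess (λ _ → 1) p ⟩
      ∑ excess p + ∑ (λ _ → 1) p            ≡⟨ cong (∑ excess p +_) (trans (∑-const 1 p) (*-identityʳ (length p))) ⟩
      ∑ excess p + length p                 ∎

    length-edges : ∀ t v ms → length (edges t v ms) ≡ length ms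
    length-edges t v []       = refl
    length-edges t v (m ∷ ms) = cong suc (length-edges (suc t) (fromMaybe v m) ms)

    -- The cost is at least 2 ^ k, and the mere length accounts for at most P, that is, at most half
    -- of this. The other half must be excess.
    rejected-excess : ∀ i → decision σ i ≡ nothing → ∀ ms → length ms ≤ P → Route (req σ i) ms →
                      2 ^ k ≤ 2 * ∑ excess (path (req σ i) ms)
    rejected-excess i eq ms ∣ms∣≤P route = +-cancelʳ-≤ (2 ^ k) (2 ^ k) _ (begin
      2 ^ k + 2 ^ k                 ≡⟨ cong (2 ^ k +_) (+-identityʳ (2 ^ k)) ⟨
      2 * 2 ^ k                     ≤⟨ *-monoʳ-≤ 2 (decide-nothing [] (requests σ) i eq ms ∣ms∣≤P route) ⟩
      2 * cost (accepted σ) p       ≡⟨ cong (2 *_) (cost≡excess+length p) ⟩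
      2 * (∑ excess p + length p)   ≡⟨ *-distribˡ-+ 2 (∑ excess p) (length p) ⟩
      2 * ∑ excess p + 2 * length p ≤⟨ +-monoʳ-≤ (2 * ∑ excess p) (≤-trans (*-monoʳ-≤ 2 ∣p∣≤P) 2*P≤2^k) ⟩
      2 * ∑ excess p + 2 ^ k        ∎)
      where
      p = path (req σ i) ms
      ∣p∣≤P : length p ≤ P
      ∣p∣≤P = ≤-trans (≤-reflexive (length-edges _ _ ms)) ∣ms∣≤P

    module _ (S′ : Schedule σ) (feasible′ : Feasible σ S′) where

      -- The bit b tells whether OPT delivers packet i on time. In that case either the algorithm
      -- accepts i, or i is charged to T paths, each with excess at least half of 2 ^ k; `charged`
      -- is their concatenation. All counts are scaled by T * 2 ^ k.
      record Charge (i : Packet σ) (b : Bool) : Set where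
        field
          charged : List Edge
          paid    : T * 2 ^ k * ⟦ b ⟧ ≤ T * 2 ^ k * ⟦ is-just (decision σ i) ⟧ + 2 * ∑ excess charged
          spread  : ∀ e → count _≟ᴱ_ e charged ≤
                          T * usesBy σ S′ i e + link e * ∑ (λ j → presentBy σ S′ i (time e ∸ j)) (upTo D)

      open Charge

      charge : ∀ i b → (b ≡ true → DeliveredOnTime σ S′ i) → Charge i b
      charge i false _ = record
        { charged = []
        ; paid    = ≤-trans (≤-reflexive (*-zeroʳ (T * 2 ^ k))) z≤n
        ; spread  = λ _ → z≤n
        }
      charge i true onTime = go (decision σ i) refl
        where
        r = req σ i
        t₀ = inputTime r
        go : ∀ x → decision σ i ≡ x → Charge i true
        go (just _) eq = record
          { charged = []
          ; paid    = ≤-trans (≤-reflexive (cong (λ x → T * 2 ^ k * ⟦ is-just x ⟧) (sym eq))) (m≤m+n _ 0)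
          ; spread  = λ _ → z≤n
          }
        go nothing eq = fromTrace (onTime refl)
          where
          fromTrace : DeliveredOnTime σ S′ i → Charge i true
          fromTrace (s , del , s≤deadline) with delivered⇒trace σ S′ feasible′ i s del
          ... | ms , tr , refl = record { charged = F ; paid = F-paid ; spread = F-spread }
            where
            departure : ℕ → List Edge
            departure s = path r (depart s ms)
            F : List Edge
            F = concatMap departure (upTo T)
            valid : Valid (destination r) (source r) ms
            valid = trace-valid r (S′ i) tr
            F-spread : ∀ e → count _≟ᴱ_ e F ≤
                             T * usesBy σ S′ i e + link e * ∑ (λ j → presentBy σ S′ i (time e ∸ j)) (upTo D)
            F-spread e = ≤-trans (≤-reflexive (∑-concatMap (λ e′ → ⟦ does (e ≟ᴱ e′) ⟧) departure (upTo T)))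
                                 (departures-count r (S′ i) ∣path∣≤D e T tr)
            expensive : ∀ {s} → s ∈ upTo T → 2 ^ k ≤ 2 * ∑ excess (departure s)
            expensive {s} s∈ = rejected-excess i eq (depart s ms)
              -- Two bounds on the length are needed: s + D ≤ P brings the path into the search
              -- space, and the length of OPT's route keeps it on time.
              (≤-trans (depart-length-≤ ∣path∣≤D s (source r) ms valid)
                       (≤-trans (+-monoˡ-≤ D (<⇒≤ (∈-upTo⁻ s∈))) T+D≤P))
              (depart-valid s (source r) ms valid ,
               Maybe.map (≤-trans (+-monoˡ-≤ t₀ (depart-length s ms))) s≤deadline)
            F-paid : T * 2 ^ k * 1 ≤ T * 2 ^ k * ⟦ is-just (decision σ i) ⟧ + 2 * ∑ excess F
            F-paid = begin
              T * 2 ^ k * 1                                  ≡⟨ *-identityʳ (T * 2 ^ k) ⟩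
              T * 2 ^ k                                      ≡⟨ cong (_* 2 ^ k) (length-upTo T) ⟨
              length (upTo T) * 2 ^ k                        ≡⟨ ∑-const (2 ^ k) (upTo T) ⟨
              ∑ (λ _ → 2 ^ k) (upTo T)                       ≤⟨ ∑-mono-∈ (upTo T) expensive ⟩
              ∑ (λ s → 2 * ∑ excess (departure s)) (upTo T)  ≡⟨ ∑-*ˡ 2 (λ s → ∑ excess (departure s)) (upTo T) ⟩
              2 * ∑ (λ s → ∑ excess (departure s)) (upTo T)  ≡⟨ cong (2 *_) (∑-concatMap excess departure (upTo T)) ⟨
              2 * ∑ excess F                                 ≤⟨ m≤n+m _ (T * 2 ^ k * ⟦ is-just (decision σ i) ⟧) ⟩
              T * 2 ^ k * ⟦ is-just (decision σ i) ⟧ + 2 * ∑ excess F ∎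

      detours : Edge → ℕ
      detours e = ∑ (λ i → link e * ∑ (λ j → presentBy σ S′ i (time e ∸ j)) (upTo D)) (packets σ S′)

      detours-bound : ∀ e → detours e ≤ T * capacity e
      detours-bound (v , nothing , t) = ≤-trans (≤-reflexive (∑-zero (packets σ S′))) z≤n
      detours-bound (v , just w  , t) = begin
        ∑ (λ i → 1 * ∑ (λ j → presentBy σ S′ i (t ∸ j)) (upTo D)) (packets σ S′)
          ≡⟨ ∑-cong (λ i → *-identityˡ _) (packets σ S′) ⟩
        ∑ (λ i → ∑ (λ j → presentBy σ S′ i (t ∸ j)) (upTo D)) (packets σ S′)
          ≡⟨ ∑-comm _ (packets σ S′) (upTo D) ⟩
        ∑ (λ j → ∑ (λ i → presentBy σ S′ i (t ∸ j)) (packets σ S′)) (upTo D)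
          -- For j > t, time 0 is counted again, which is harmless as the bound holds at every time.
          ≤⟨ ∑-mono (λ j → ∑-present ∈vertices ∈neighbours degree≤d σ S′ feasible′ (t ∸ j)) (upTo D) ⟩
        ∑ (λ _ → length vertices * (B + d * c)) (upTo D)
          ≡⟨ trans (∑-const _ (upTo D)) (cong (_* (length vertices * (B + d * c))) (length-upTo D)) ⟩
        D * (length vertices * (B + d * c))
          ≤⟨ detours≤ ⟩
        T * c ∎

      -- The shared parts and the detours each load e at most T times its capacity, and the capacity
      -- is at most 2 * k * q e; hence the factor 4.
      charge-total : (charges : ∀ i → List Edge) →
                     (∀ i e → count _≟ᴱ_ e (charges i) ≤
                              T * usesBy σ S′ i e + link e * ∑ (λ j → presentBy σ S′ i (time e ∸ j)) (upTo D)) →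
                     ∀ e → count _≟ᴱ_ e (concatMap charges (packets σ S′)) ≤ 4 * k * T * q e
      charge-total charges spread e = begin
        count _≟ᴱ_ e (concatMap charges ps)
          ≡⟨ ∑-concatMap (λ e′ → ⟦ does (e ≟ᴱ e′) ⟧) charges ps ⟩
        ∑ (λ i → count _≟ᴱ_ e (charges i)) ps
          ≤⟨ ∑-mono (λ i → spread i e) ps ⟩
        ∑ (λ i → T * usesBy σ S′ i e + link e * ∑ (λ j → presentBy σ S′ i (time e ∸ j)) (upTo D)) ps
          ≡⟨ ∑-+ _ _ ps ⟩
        ∑ (λ i → T * usesBy σ S′ i e) ps + detours e
          ≡⟨ cong (_+ detours e) (∑-*ˡ T (λ i → usesBy σ S′ i e) ps) ⟩
        T * ∑ (λ i → usesBy σ S′ i e) ps + detours e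
          ≤⟨ +-mono-≤ (*-monoʳ-≤ T (uses≤capacity σ S′ feasible′ e)) (detours-bound e) ⟩
        T * capacity e + T * capacity e
          ≤⟨ +-mono-≤ (*-monoʳ-≤ T (capacity≤2*k*q e)) (*-monoʳ-≤ T (capacity≤2*k*q e)) ⟩
        T * (2 * k * q e) + T * (2 * k * q e)
          ≡⟨ regroup T k (q e) ⟩
        4 * k * T * q e ∎
        where
        ps = packets σ S′
        regroup : ∀ T k q → T * (2 * k * q) + T * (2 * k * q) ≡ 4 * k * T * q
        regroup = solve-∀

      -- Multiplying by the q of the other kind of edge gives all edges the
      -- common value qᴮ * qᶜ.
      cofactor : Edge → ℕ
      cofactor (_ , nothing , _) = c / k
      cofactor (_ , just _  , _) = B / k

      q*cofactor : ∀ e → q e * cofactor e ≡ (B / k) * (c / k)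
      q*cofactor (_ , nothing , _) = refl
      q*cofactor (_ , just _  , _) = *-comm (c / k) (B / k)

      -- A packet of OPT is either accepted, which gives the 1, or charged to paths whose doubled
      -- excess is at least T * 2 ^ k. The doubling and the 4 * k * T of `charge-total` give 8 * k.
      throughput-bound : ∀ {o} → Throughput σ S′ o → o ≤ (1 + 8 * k) * length (accepted σ)
      throughput-bound {o} (X , ∈X⇔ , ∣X∣≡o) = *-cancelˡ-≤ (T * 2 ^ k) {{T*2^k≢0}} (begin
        T * 2 ^ k * o
          ≡⟨ cong (T * 2 ^ k *_) (trans (sym ∣X∣≡o) (∣∣≡∑ X)) ⟩
        T * 2 ^ k * ∑ (λ i → ⟦ Vec.lookup X i ⟧) ps
          ≡⟨ ∑-*ˡ (T * 2 ^ k) _ ps ⟨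
        ∑ (λ i → T * 2 ^ k * ⟦ Vec.lookup X i ⟧) ps
          ≤⟨ ∑-mono (λ i → paid (charges i)) ps ⟩
        ∑ (λ i → T * 2 ^ k * ⟦ is-just (decision σ i) ⟧ + 2 * ∑ excess (charged (charges i))) ps
          ≡⟨ ∑-+ _ _ ps ⟩
        ∑ (λ i → T * 2 ^ k * ⟦ is-just (decision σ i) ⟧) ps + ∑ (λ i → 2 * ∑ excess (charged (charges i))) ps
          ≡⟨ cong₂ _+_ (∑-*ˡ (T * 2 ^ k) _ ps) (∑-*ˡ 2 _ ps) ⟩
        T * 2 ^ k * ∑ (λ i → ⟦ is-just (decision σ i) ⟧) ps + 2 * ∑ (λ i → ∑ excess (charged (charges i))) ps
          ≡⟨ cong₂ (λ x y → T * 2 ^ k * x + 2 * y)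
                   (trans (sym (+-identityʳ _)) (length-final [] (requests σ)))
                   (sym (∑-concatMap excess (λ i → charged (charges i)) ps)) ⟩
        T * 2 ^ k * length (accepted σ) + 2 * ∑ excess F
          ≤⟨ +-monoʳ-≤ (T * 2 ^ k * length (accepted σ)) (*-monoʳ-≤ 2 (charging cofactor {N = 4 * k * T} q*cofactor F
               (charge-total (λ i → charged (charges i)) (λ i → spread (charges i)))
               {{Q≢0}} (final-affordable (requests σ) []))) ⟩
        T * 2 ^ k * length (accepted σ) + 2 * (4 * k * T * (length (accepted σ) * 2 ^ k))
          ≡⟨ regroup T (2 ^ k) (length (accepted σ)) k ⟩
        T * 2 ^ k * ((1 + 8 * k) * length (accepted σ)) ∎)
        where
        ps = packets σ S′
        charges : ∀ i → Charge i (Vec.lookup X i)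
        charges i = charge i (Vec.lookup X i) (λ i∈ → Equivalence.to (∈X⇔ i) (Vec.lookup⇒[]= i X i∈))
        F = concatMap (λ i → charged (charges i)) ps
        T*2^k≢0 : NonZero (T * 2 ^ k)
        T*2^k≢0 = m*n≢0 T (2 ^ k) {{it}} {{m^n≢0 2 k}}
        Q≢0 : NonZero ((B / k) * (c / k))
        Q≢0 = m*n≢0 (B / k) (c / k) {{>-nonZero (m≥n⇒m/n>0 k≤B)}} {{>-nonZero (m≥n⇒m/n>0 k≤c)}}
        regroup : ∀ T x a k → T * x * a + 2 * (4 * k * T * (a * x)) ≡ T * x * ((1 + 8 * k) * a)
        regroup = solve-∀

    competitive : ∃ λ a → Throughput σ (S σ) a × (∀ o → IsOPT σ o → o ≤ (1 + 8 * k) * a)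
    competitive = length (accepted σ) , throughput σ ,
      λ { o ((S′ , feasible′ , throughput′) , _) → throughput-bound S′ feasible′ throughput′ }

-- The grid

length-cartesianProductWith : ∀ {X Y Z : Set} (f : X → Y → Z) xs ys →
                              length (cartesianProductWith f xs ys) ≡ length xs * length ys
length-cartesianProductWith f []       ys = refl
length-cartesianProductWith f (x ∷ xs) ys =
  trans (length-++ (map (f x) ys))
        (cong₂ _+_ (length-map (f x) ys) (length-cartesianProductWith f xs ys))

allVertices : ∀ {d} (ℓ : Vec ℕ d) → List (Vertex ℓ)
allVertices []      = Allᵛ.[] ∷ []
allVertices (m ∷ ℓ) = cartesianProductWith Allᵛ._∷_ (allFin m) (allVertices ℓ)

∈-allVertices : ∀ {d} {ℓ : Vec ℕ d} (v : Vertex ℓ) → v ∈ allVertices ℓ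
∈-allVertices Allᵛ.[]       = here refl
∈-allVertices (x Allᵛ.∷ xs) = ∈-cartesianProductWith⁺ Allᵛ._∷_ (∈-allFin x) (∈-allVertices xs)

length-allVertices : ∀ {d} (ℓ : Vec ℕ d) → length (allVertices ℓ) ≡ gridSize ℓ
length-allVertices []      = refl
length-allVertices (m ∷ ℓ) =
  trans (length-cartesianProductWith Allᵛ._∷_ (allFin m) (allVertices ℓ))
        (cong₂ _*_ (length-tabulate {n = m} id) (length-allVertices ℓ))

coords-injective : ∀ {d} {ℓ : Vec ℕ d} (u v : Vertex ℓ) → coords u ≡ coords v → u ≡ v
coords-injective Allᵛ.[]       Allᵛ.[]       _  = refl
coords-injective (x Allᵛ.∷ xs) (y Allᵛ.∷ ys) eq =
  cong₂ Allᵛ._∷_ (Fin.toℕ-injective (Vec.∷-injectiveˡ eq)) (coords-injective xs ys (Vec.∷-injectiveʳ eq))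

module _ {m d : ℕ} {ℓ : Vec ℕ d} where

  bump : (x : Fin m) → Vertex ℓ → Dec (suc (toℕ x) < m) → List (Vertex (m ∷ ℓ))
  bump x xs (yes 1+x<m) = (fromℕ< 1+x<m Allᵛ.∷ xs) ∷ []
  bump x xs (no _)      = []

  length-bump : ∀ x xs <? → length (bump x xs <?) ≤ 1
  length-bump x xs (yes _) = ≤-refl
  length-bump x xs (no _)  = z≤n

  ∈-bump : ∀ x xs <? y → toℕ y ≡ suc (toℕ x) → (y Allᵛ.∷ xs) ∈ bump x xs <?
  ∈-bump x xs (yes 1+x<m) y y≡ =
    here (cong (Allᵛ._∷ xs) (Fin.toℕ-injective (trans y≡ (sym (Fin.toℕ-fromℕ< 1+x<m)))))
  ∈-bump x xs (no 1+x≮m)  y y≡ = contradiction (subst (_< m) y≡ (Fin.toℕ<n y)) 1+x≮m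

neighbours : ∀ {d} {ℓ : Vec ℕ d} → Vertex ℓ → List (Vertex ℓ)
neighbours Allᵛ.[]                     = []
neighbours {ℓ = m ∷ _} (x Allᵛ.∷ xs) =
  bump x xs (suc (toℕ x) <? m) ++ map (x Allᵛ.∷_) (neighbours xs)

length-neighbours : ∀ {d} {ℓ : Vec ℕ d} (v : Vertex ℓ) → length (neighbours v) ≤ d
length-neighbours Allᵛ.[]                           = z≤n
length-neighbours {ℓ = m ∷ _} (x Allᵛ.∷ xs) = ≤-trans
  (≤-reflexive (trans (length-++ (bump x xs (suc (toℕ x) <? m)))
                      (cong (length (bump x xs (suc (toℕ x) <? m)) +_) (length-map (x Allᵛ.∷_) (neighbours xs)))))
  (+-mono-≤ (length-bump x xs (suc (toℕ x) <? m)) (length-neighbours xs))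

∈-neighbours : ∀ {d} {ℓ : Vec ℕ d} {u v : Vertex ℓ} → Digraph._⟶_ (Grid ℓ) u v → v ∈ neighbours u
∈-neighbours {ℓ = m ∷ _} {x Allᵛ.∷ xs} {y Allᵛ.∷ ys} (zero , eq)
  with refl ← coords-injective ys xs (Vec.∷-injectiveʳ eq) =
  ∈-++⁺ˡ (∈-bump x xs (suc (toℕ x) <? m) y (Vec.∷-injectiveˡ eq))
∈-neighbours {ℓ = m ∷ _} {x Allᵛ.∷ xs} {y Allᵛ.∷ ys} (suc j , eq)
  with refl ← Fin.toℕ-injective (Vec.∷-injectiveˡ eq) =
  ∈-++⁺ʳ (bump x xs (suc (toℕ x) <? m)) (∈-map⁺ (x Allᵛ.∷_) (∈-neighbours (j , Vec.∷-injectiveʳ eq)))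

grid-edge? : ∀ {d} (ℓ : Vec ℕ d) → Decidable (Digraph._⟶_ (Grid ℓ))
grid-edge? ℓ u v = Fin.any? λ j → Vec.≡-dec _≟_ (coords v) (coords u [ j ]%= suc)

sum-bump : ∀ {d} (xs : Vec ℕ d) j → Vec.sum (xs [ j ]%= suc) ≡ suc (Vec.sum xs)
sum-bump (x ∷ xs) zero    = refl
sum-bump (x ∷ xs) (suc j) = trans (cong (x +_) (sum-bump xs j)) (+-suc x (Vec.sum xs))

-- Every edge raises the coordinate sum by one.
sum-path : ∀ {d} (ℓ : Vec ℕ d) {u v : Vertex ℓ} (p : Star (Digraph._⟶_ (Grid ℓ)) u v) →
           pathLength (Grid ℓ) p + Vec.sum (coords u) ≡ Vec.sum (coords v)
sum-path ℓ ε = refl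
sum-path ℓ {u} (_◅_ {j = w} (j , eq) p) =
  trans (sym (+-suc (pathLength (Grid ℓ) p) (Vec.sum (coords u))))
        (trans (cong (pathLength (Grid ℓ) p +_) (sym (trans (cong Vec.sum eq) (sum-bump (coords u) j))))
               (sum-path ℓ p))

-- Expanding the product of all 1 + x gives 1, the sum of the x and further non-negative terms. As
-- path lengths are differences of coordinate sums, the diameter is thus less than the number of
-- vertices.
sum-coords< : ∀ {d} {ℓ : Vec ℕ d} (v : Vertex ℓ) → Vec.sum (coords v) < gridSize ℓ
sum-coords< Allᵛ.[] = ≤-refl
sum-coords< {ℓ = m ∷ ℓ} (x Allᵛ.∷ xs) = begin-strict
  toℕ x + Vec.sum (coords xs)                             ≤⟨ m≤m+n _ (toℕ x * Vec.sum (coords xs)) ⟩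
  toℕ x + Vec.sum (coords xs) + toℕ x * Vec.sum (coords xs) <⟨ ≤-refl ⟩
  suc (toℕ x + Vec.sum (coords xs) + toℕ x * Vec.sum (coords xs)) ≡⟨ expand (toℕ x) (Vec.sum (coords xs)) ⟩
  suc (toℕ x) * suc (Vec.sum (coords xs))                 ≤⟨ *-mono-≤ (Fin.toℕ<n x) (sum-coords< xs) ⟩
  m * gridSize ℓ                                          ∎
  where
  open ≤-Reasoning
  expand : ∀ x s → suc (x + s + x * s) ≡ suc x * suc s
  expand = solve-∀

origin : ∀ {d} (ℓ : Vec ℕ d) → 1 ≤ gridSize ℓ → Vertex ℓ
origin []          _   = Allᵛ.[]
origin (suc m ∷ ℓ) 1≤n = zero Allᵛ.∷ origin ℓ (n≢0⇒n>0 λ g≡0 → >⇒≢ 1≤n (trans (cong (suc m *_) g≡0) (*-zeroʳ m)))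

-- Taken in the first direction of length at least 2; it shows that the diameter is positive.
grid-edge : ∀ {d} (ℓ : Vec ℕ d) → 2 ≤ gridSize ℓ → ∃₂ (Digraph._⟶_ (Grid ℓ))
grid-edge []                2≤1 = contradiction 2≤1 λ { (s≤s ()) }
grid-edge (suc zero ∷ ℓ)    2≤n with grid-edge ℓ (subst (2 ≤_) (+-identityʳ (gridSize ℓ)) 2≤n)
... | u , v , j , eq = zero Allᵛ.∷ u , zero Allᵛ.∷ v , suc j , cong (0 ∷_) eq
grid-edge (suc (suc m) ∷ ℓ) 2≤n = zero Allᵛ.∷ o , suc zero Allᵛ.∷ o , zero , refl
  where
  o : Vertex ℓ
  o = origin ℓ (n≢0⇒n>0 λ g≡0 → >⇒≢ (<-trans z<s 2≤n) (trans (cong (suc (suc m) *_) g≡0) (*-zeroʳ m)))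

module _ {d : ℕ} (ℓ : Vec ℕ d) {diam : ℕ} (isDiam : IsDiameter (Grid ℓ) diam) where

  -- By `sum-path`, all paths between two given vertices are equally long, so each is a shortest
  -- one.
  pathLength≤diam : ∀ {u v} (p : Star (Digraph._⟶_ (Grid ℓ)) u v) → pathLength (Grid ℓ) p ≤ diam
  pathLength≤diam {u} {v} p = proj₂ isDiam u v (pathLength (Grid ℓ) p) ((p , refl) , λ p′ →
    ≤-reflexive (+-cancelʳ-≡ (Vec.sum (coords u)) _ _ (trans (sum-path ℓ p) (sym (sum-path ℓ p′)))))

  1≤diam : 2 ≤ gridSize ℓ → 1 ≤ diam
  1≤diam 2≤n with grid-edge ℓ 2≤n
  ... | u , v , u⟶v = pathLength≤diam (u⟶v ◅ ε)

  diam<gridSize : diam < gridSize ℓ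
  diam<gridSize with proj₁ isDiam
  ... | u , v , (p , refl) , _ = ≤-<-trans
    (≤-trans (m≤m+n _ (Vec.sum (coords u))) (≤-reflexive (sum-path ℓ p))) (sum-coords< v)

-- Size of the parameters

-- Records the exact, possibly unreduced, representation of a non-negative rational, so that the
-- definition of k becomes inequalities between natural numbers.
record Fraction (p : ℚᵘ) (a b : ℕ) : Set where
  constructor fraction
  field
    numerator   : ↥ p ≡ ℤ.+ a
    denominator : ↧ₙ p ≡ b

fraction-/ : ∀ a b .{{_ : NonZero b}} → Fraction (ℤ.+ a ℚᵘ./ b) a b
fraction-/ a (suc b) = fraction refl refl

fraction-* : ∀ {p p′ a a′ b b′} → Fraction p a b → Fraction p′ a′ b′ → Fraction (p ℚᵘ.* p′) (a * a′) (b * b′)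
fraction-* {mkℚᵘ _ _} {mkℚᵘ _ _} {a} {a′} (fraction refl refl) (fraction refl refl) =
  fraction (sym (ℤ.pos-* a a′)) refl

fraction-+ : ∀ {p p′ a a′ b b′} → Fraction p a b → Fraction p′ a′ b′ →
             Fraction (p ℚᵘ.+ p′) (a * b′ + a′ * b) (b * b′)
fraction-+ {mkℚᵘ _ _} {mkℚᵘ _ _} {a} {a′} {b} {b′} (fraction refl refl) (fraction refl refl) =
  fraction (trans (cong₂ ℤ._+_ (sym (ℤ.pos-* a b′)) (sym (ℤ.pos-* a′ b))) (sym (ℤ.pos-+ (a * b′) (a′ * b)))) refl

-- The ceiling is the negated floor of - a / b, and r is the remainder of - a modulo b.
ceiling-remainder : ∀ {p a b} → Fraction p a b → ∃ λ r → r < b × ℤ.∣ ℚᵘ.ceiling p ∣ * b ≡ a + r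
ceiling-remainder {mkℚᵘ _ b-1} {a} (fraction refl refl) = r , ℤ.n%d<d n b , (begin
  ℤ.∣ z ∣ * suc b-1         ≡⟨ ℤ.abs-* z b ⟨
  ℤ.∣ z ℤ.* b ∣             ≡⟨ cong ℤ.∣_∣ z*b≡ ⟩
  ℤ.∣ ℤ.+ a ℤ.+ ℤ.+ r ∣     ∎)
  where
  open ≡-Reasoning
  n = ℤ.- ℤ.+ a
  b = ℤ.+ suc b-1
  r = n ℤ.% b
  z = ℤ.- (n ℤ./ b)
  z*b≡ : z ℤ.* b ≡ ℤ.+ a ℤ.+ ℤ.+ r
  z*b≡ = begin
    z ℤ.* b                                 ≡⟨ ℤ.neg-distribˡ-* (n ℤ./ b) b ⟨
    ℤ.- (n ℤ./ b ℤ.* b)                     ≡⟨ complement (ℤ.+ r) (n ℤ./ b ℤ.* b) ⟩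
    ℤ.- (ℤ.+ r ℤ.+ n ℤ./ b ℤ.* b) ℤ.+ ℤ.+ r ≡⟨ cong (λ x → ℤ.- x ℤ.+ ℤ.+ r) (ℤ.a≡a%n+[a/n]*n n b) ⟨
    ℤ.- n ℤ.+ ℤ.+ r                         ≡⟨ cong (ℤ._+ ℤ.+ r) (ℤ.neg-involutive (ℤ.+ a)) ⟩
    ℤ.+ a ℤ.+ ℤ.+ r                         ∎
    where
    complement : ∀ i j → ℤ.- j ≡ ℤ.- (i ℤ.+ j) ℤ.+ i
    complement = ℤ-solve-∀

n≤2^⌈log₂n⌉ : ∀ n → n ≤ 2 ^ ⌈log₂ n ⌉
n≤2^⌈log₂n⌉ = <-rec _ go
  where
  open ≤-Reasoning
  go : ∀ n → (∀ {m} → m < n → m ≤ 2 ^ ⌈log₂ m ⌉) → n ≤ 2 ^ ⌈log₂ n ⌉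
  go 0 _ = z≤n
  go 1 _ = ≤-refl
  go n@(suc (suc m)) rec = begin
    n                               ≡⟨ ⌊n/2⌋+⌈n/2⌉≡n n ⟨
    ⌊ n /2⌋ + ⌈ n /2⌉               ≤⟨ +-monoˡ-≤ ⌈ n /2⌉ (⌊n/2⌋≤⌈n/2⌉ n) ⟩
    ⌈ n /2⌉ + ⌈ n /2⌉               ≡⟨ cong (⌈ n /2⌉ +_) (+-identityʳ ⌈ n /2⌉) ⟨
    2 * ⌈ n /2⌉                     ≤⟨ *-monoʳ-≤ 2 (rec (⌈n/2⌉<n m)) ⟩
    2 ^ suc ⌈log₂ ⌈ n /2⌉ ⌉         ≡⟨ cong (λ x → 2 ^ suc x) (⌈log₂⌈n/2⌉⌉≡⌈log₂n⌉∸1 n) ⟩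
    2 ^ (1 + (⌈log₂ n ⌉ ∸ 1))       ≡⟨ cong (2 ^_) (m+[n∸m]≡n (⌈log₂⌉-mono-≤ {2} {n} (s≤s (s≤s z≤n)))) ⟩
    2 ^ ⌈log₂ n ⌉                   ∎

n<2^[1+⌊log₂n⌋] : ∀ n → n < 2 ^ suc ⌊log₂ n ⌋
n<2^[1+⌊log₂n⌋] n = ≰⇒> λ 2^≤n →
  1+n≰n (subst (_≤ ⌊log₂ n ⌋) (⌊log₂[2^n]⌋≡n (suc ⌊log₂ n ⌋)) (⌊log₂⌋-mono-≤ 2^≤n))

^-distribʳ-* : ∀ m n o → (m * n) ^ o ≡ m ^ o * n ^ o
^-distribʳ-* m n zero    = refl
^-distribʳ-* m n (suc o) = trans (cong (m * n *_) (^-distribʳ-* m n o)) ([m*n]*[o*p]≡[m*o]*[n*p] m n (m ^ o) (n ^ o))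

^-cancelʳ-≤ : ∀ r .{{_ : NonZero r}} {m n} → m ^ r ≤ n ^ r → m ≤ n
^-cancelʳ-≤ r m^r≤n^r = ≮⇒≥ λ n<m → <⇒≱ (^-monoˡ-< r n<m) m^r≤n^r

module _ (n d c B diam : ℕ) .{{_ : NonZero c}} where

  open Parameters n d c B diam

  private
    x : ℚᵘ
    x = fromℕ 1 ℚᵘ.+ fromℕ 3 ℚᵘ.* pmax
    X = ℤ.∣ ℚᵘ.ceiling x ∣
    -- This is c times 1 + 3 * `pmax`, with all denominators cleared.
    a = c + 3 * ((2 * n * (d * c + B) + 2 * c) * diam)

    fraction-x : Fraction x a c
    fraction-x = subst₂ (Fraction x) (numerator≡ n d c B diam) (denominator≡ c)
      (fraction-+ (fraction-/ 1 1) (fraction-* (fraction-/ 3 1)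
        (fraction-* (fraction-+ (fraction-* (fraction-/ (2 * n) 1) (fraction-+ (fraction-/ d 1) (fraction-/ B c)))
                                (fraction-/ 2 1))
                    (fraction-/ diam 1))))
      where
      denominator≡ : ∀ c → 1 * (1 * (1 * (1 * c) * 1 * 1)) ≡ c
      denominator≡ = solve-∀
      numerator≡ : ∀ n d c B diam →
        1 * (1 * (1 * (1 * c) * 1 * 1)) + 3 * ((2 * n * (d * c + B * 1) * 1 + 2 * (1 * (1 * c))) * diam) * 1 ≡
        c + 3 * ((2 * n * (d * c + B) + 2 * c) * diam)
      numerator≡ = solve-∀

  k-lower : c + 3 * ((2 * n * (d * c + B) + 2 * c) * diam) ≤ 2 ^ k * c
  k-lower with ceiling-remainder fraction-x
  ... | r , _ , X*c≡ = begin
    a           ≤⟨ m≤m+n a r ⟩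
    a + r       ≡⟨ X*c≡ ⟨
    X * c       ≤⟨ *-monoˡ-≤ c (n≤2^⌈log₂n⌉ X) ⟩
    2 ^ k * c   ∎
    where open ≤-Reasoning

  -- Rounding up adds less than 1, which after multiplication by c is less than the extra c.
  k-upper : ∀ {Y m} → a + c ≤ Y * c → Y ≤ 2 ^ m → k ≤ m
  k-upper {Y} {m} a+c≤Y*c Y≤2^m with ceiling-remainder fraction-x
  ... | r , r<c , X*c≡ = subst (k ≤_) (⌈log₂2^n⌉≡n m) (⌈log₂⌉-mono-≤ (≤-trans X≤Y Y≤2^m))
    where
    X≤Y : X ≤ Y
    X≤Y = *-cancelʳ-≤ X Y c (≤-trans (≤-trans (≤-reflexive X*c≡) (+-monoʳ-≤ a (<⇒≤ r<c))) a+c≤Y*c)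

-- Prepares the choice of 2 ^ k′ for P and 2 ^ k′ ∸ D for T. With W the detour load, the lower bound
-- on 2 ^ k * c is c + 6 * W + 6 * D * c, so 2 ^ k′ * c is at least 3 * (W + D * c), which is more
-- than enough. For k = 0 the bound would exceed c itself.
half-power : ∀ n d c B D k → 1 ≤ c → 1 ≤ D →
             c + 3 * ((2 * n * (d * c + B) + 2 * c) * D) ≤ 2 ^ k * c →
             ∃ λ k′ → k ≡ suc k′ × D < 2 ^ k′ × D * (n * (B + d * c)) ≤ (2 ^ k′ ∸ D) * c
half-power n d c B D zero 1≤c 1≤D lower = contradiction lower (<⇒≱ (begin-strict
  1 * c                                        ≡⟨ *-identityˡ c ⟩
  c                                            <⟨ m<m+n c (*-mono-≤ 1≤D 1≤c) ⟩
  c + D * c                                    ≤⟨ +-monoʳ-≤ c (m≤n+m (D * c) (6 * (D * (n * (B + d * c))) + 5 * (D * c))) ⟩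
  c + (6 * (D * (n * (B + d * c))) + 5 * (D * c) + D * c) ≡⟨ regroup n d c B D ⟨
  c + 3 * ((2 * n * (d * c + B) + 2 * c) * D)  ∎))
  where
  open ≤-Reasoning
  regroup : ∀ n d c B D → c + 3 * ((2 * n * (d * c + B) + 2 * c) * D) ≡
                          c + (6 * (D * (n * (B + d * c))) + 5 * (D * c) + D * c)
  regroup = solve-∀
half-power n d c B D (suc k′) 1≤c 1≤D lower = k′ , refl , D<M , (begin
  W                      ≡⟨ m+n∸n≡m W (D * c) ⟨
  W + D * c ∸ D * c      ≤⟨ ∸-monoˡ-≤ (D * c) (≤-trans (m≤m+n (W + D * c) (2 * W + 2 * (D * c))) M*c≥) ⟩
  M * c ∸ D * c          ≡⟨ *-distribʳ-∸ c M D ⟨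
  (M ∸ D) * c            ∎)
  where
  open ≤-Reasoning
  M = 2 ^ k′
  W = D * (n * (B + d * c))
  M*c≥ : W + D * c + (2 * W + 2 * (D * c)) ≤ M * c
  M*c≥ = *-cancelˡ-≤ 2 (begin
    2 * (W + D * c + (2 * W + 2 * (D * c)))     ≤⟨ m≤n+m _ c ⟩
    c + 2 * (W + D * c + (2 * W + 2 * (D * c))) ≡⟨ regroup n d c B D ⟩
    c + 3 * ((2 * n * (d * c + B) + 2 * c) * D) ≤⟨ lower ⟩
    2 * M * c                                   ≡⟨ *-assoc 2 M c ⟩
    2 * (M * c)                                 ∎)
    where
    regroup : ∀ n d c B D →
      let W = D * (n * (B + d * c)) in
      c + 2 * (W + D * c + (2 * W + 2 * (D * c))) ≡ c + 3 * ((2 * n * (d * c + B) + 2 * c) * D)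
    regroup = solve-∀
  D<M : D < M
  D<M = *-cancelʳ-≤ (suc D) M c {{>-nonZero 1≤c}} (begin
    c + D * c                               ≡⟨ cong (_+ D * c) (*-identityˡ c) ⟨
    1 * c + D * c                           ≤⟨ +-monoˡ-≤ (D * c) (*-monoˡ-≤ c 1≤D) ⟩
    D * c + D * c                           ≤⟨ +-mono-≤ (m≤n+m (D * c) W) (≤-trans (m≤m+n (D * c) (D * c + 0)) (m≤n+m (2 * (D * c)) (2 * W))) ⟩
    W + D * c + (2 * W + 2 * (D * c))       ≤⟨ M*c≥ ⟩
    M * c                                   ∎)

n<2^n : ∀ n → n < 2 ^ n
n<2^n zero    = ≤-refl
n<2^n (suc n) = begin-strict
  suc n           ≤⟨ n<2^n n ⟩
  2 ^ n           <⟨ m<m+n (2 ^ n) (≤-trans (m^n>0 2 n) (m≤m+n (2 ^ n) 0)) ⟩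
  2 ^ suc n       ∎
  where open ≤-Reasoning

-- With d ≤ n ^ d, B ≤ c * n ^ p and D < n, the largest term is of order n ^ 2 * n ^ (d + p) times
-- c. The exponent 7 consists of this 2 and of 5 for the constant.
polynomial-bound : ∀ n d p c B D → 2 ≤ n → D < n → B ≤ c * n ^ p →
                   c + 3 * ((2 * n * (d * c + B) + 2 * c) * D) + c ≤ n ^ (7 + (d + p)) * c
polynomial-bound n d p c B D 2≤n D<n B≤ = begin
  c + 3 * ((2 * n * (d * c + B) + 2 * c) * D) + c
    ≤⟨ +-monoˡ-≤ c (+-monoʳ-≤ c (*-monoʳ-≤ 3 (*-mono-≤
         (+-monoˡ-≤ (2 * c) (*-monoʳ-≤ (2 * n) (+-mono-≤ (*-monoˡ-≤ c d≤N) B≤N*c))) (<⇒≤ D<n)))) ⟩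
  c + 3 * ((2 * n * (N * c + N * c) + 2 * c) * n) + c
    ≡⟨ expand n N c ⟩
  12 * (N * n * n) * c + 6 * (1 * n) * c + 2 * 1 * c
    ≤⟨ +-mono-≤ (+-monoʳ-≤ (12 * (N * n * n) * c) (*-monoˡ-≤ c (*-monoʳ-≤ 6 (*-monoˡ-≤ n 1≤N*n))))
                (*-monoˡ-≤ c (*-monoʳ-≤ 2 (*-mono-≤ 1≤N*n 1≤n))) ⟩
  12 * (N * n * n) * c + 6 * (N * n * n) * c + 2 * (N * n * n) * c
    -- The coefficients add up to 20, padded to 32 = 2 ^ 5, which is at most n ^ 5.
    ≤⟨ m≤m+n _ (12 * (N * n * n) * c) ⟩
  12 * (N * n * n) * c + 6 * (N * n * n) * c + 2 * (N * n * n) * c + 12 * (N * n * n) * c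
    ≡⟨ collect n N c ⟩
  2 ^ 5 * (n * n * N) * c
    ≤⟨ *-monoˡ-≤ c (*-monoˡ-≤ (n * n * N) (^-monoˡ-≤ 5 2≤n)) ⟩
  n ^ 5 * (n * n * N) * c
    ≡⟨ cong (_* c) (powers n N) ⟩
  n ^ 7 * N * c
    ≡⟨ cong (_* c) (^-distribˡ-+-* n 7 (d + p)) ⟨
  n ^ (7 + (d + p)) * c ∎
  where
  open ≤-Reasoning
  N = n ^ (d + p)
  1≤n = ≤-trans (s≤s z≤n) 2≤n
  instance
    n≢0 : NonZero n
    n≢0 = >-nonZero 1≤n
  d≤N : d ≤ N
  d≤N = ≤-trans (<⇒≤ (n<2^n d)) (≤-trans (^-monoˡ-≤ d 2≤n) (^-monoʳ-≤ n (m≤m+n d p)))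
  B≤N*c : B ≤ N * c
  B≤N*c = ≤-trans B≤ (≤-trans (≤-reflexive (*-comm c (n ^ p))) (*-monoˡ-≤ c (^-monoʳ-≤ n (m≤n+m p d))))
  1≤N*n : 1 ≤ N * n
  1≤N*n = *-mono-≤ (m^n>0 n (d + p)) 1≤n
  expand : ∀ n N c → c + 3 * ((2 * n * (N * c + N * c) + 2 * c) * n) + c ≡
                     12 * (N * n * n) * c + 6 * (1 * n) * c + 2 * 1 * c
  expand = solve-∀
  collect : ∀ n N c → 12 * (N * n * n) * c + 6 * (N * n * n) * c + 2 * (N * n * n) * c + 12 * (N * n * n) * c ≡
                      32 * (n * n * N) * c
  collect = solve-∀
  powers : ∀ n N → n * (n * (n * (n * (n * 1)))) * (n * n * N) ≡ n * (n * (n * (n * (n * (n * (n * 1)))))) * N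
  powers = solve-∀

-- Take a rational q = p / r above C. As r ≥ 1, the exponent p / r can be raised to the integer p.
ratio-bound : ∀ B c n C .{{_ : NonZero n}} → RatioAtMostPower B c n C →
              let p = ℤ.∣ ↥ proj₁ (upperNonempty C) ∣ in B ≤ c * n ^ p
ratio-bound B c n C ratio = ^-cancelʳ-≤ r (begin
  B ^ r                  ≤⟨ ratio q (proj₂ (upperNonempty C)) ⟩
  c ^ r * n ^ p          ≤⟨ *-monoʳ-≤ (c ^ r) (^-monoʳ-≤ n (m≤m*n p r)) ⟩
  c ^ r * n ^ (p * r)    ≡⟨ cong (c ^ r *_) (^-*-assoc n p r) ⟨
  c ^ r * (n ^ p) ^ r    ≡⟨ ^-distribʳ-* c (n ^ p) r ⟨
  (c * n ^ p) ^ r        ∎)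
  where
  open ≤-Reasoning
  q = proj₁ (upperNonempty C)
  r = ↧ₙ q
  p = ℤ.∣ ↥ q ∣

-- With l = `⌊log₂ n ⌋` ≥ 1, n is less than 2 ^ (1 + l) and so at most 2 ^ (2 * l). This gives k ≤ 2
-- * l * e, and l ≥ 1 also absorbs the summand 1.
logarithmic : ∀ n e k → 2 ≤ n → (∀ m → n ^ e ≤ 2 ^ m → k ≤ m) → 1 + 8 * k ≤ (1 + 16 * e) * ⌊log₂ n ⌋
logarithmic n e k 2≤n k≤ = begin
  1 + 8 * k             ≤⟨ +-mono-≤ 1≤l (*-monoʳ-≤ 8 (k≤ (2 * l * e) n^e≤)) ⟩
  l + 8 * (2 * l * e)   ≡⟨ regroup l e ⟩
  (1 + 16 * e) * l      ∎
  where
  open ≤-Reasoning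
  l = ⌊log₂ n ⌋
  1≤l : 1 ≤ l
  1≤l = ⌊log₂⌋-mono-≤ 2≤n
  n^e≤ : n ^ e ≤ 2 ^ (2 * l * e)
  n^e≤ = begin
    n ^ e               ≤⟨ ^-monoˡ-≤ e (<⇒≤ (n<2^[1+⌊log₂n⌋] n)) ⟩
    (2 ^ (1 + l)) ^ e   ≤⟨ ^-monoˡ-≤ e (^-monoʳ-≤ 2 (+-monoˡ-≤ l 1≤l)) ⟩
    (2 ^ (l + l)) ^ e   ≡⟨ cong (λ x → (2 ^ (l + x)) ^ e) (+-identityʳ l) ⟨
    (2 ^ (2 * l)) ^ e   ≡⟨ ^-*-assoc 2 (2 * l) e ⟩
    2 ^ (2 * l * e)     ∎
  regroup : ∀ l e → l + 8 * (2 * l * e) ≡ (1 + 16 * e) * l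
  regroup = solve-∀

-- The algorithm on the grid

module _ {d : ℕ} (ℓ : Vec ℕ d) (c B diam : ℕ) .{{_ : NonZero c}} (2≤n : 2 ≤ gridSize ℓ)
         (isDiam : IsDiameter (Grid ℓ) diam) where

  private
    k = Parameters.k (gridSize ℓ) d c B diam

  grid-algorithm : k ≤ B → k ≤ c →
    ∃ λ (A : GridRouting.OnlineAlgorithm ℓ c B) →
      GridRouting.AlwaysFeasible ℓ c B A ×
      GridRouting.Competitive ℓ c B (1 + 8 * k) A ×
      GridRouting.NonPreemptive ℓ c B A
  grid-algorithm k≤B k≤c
    with half-power (gridSize ℓ) d c B diam k (>-nonZero⁻¹ c) (1≤diam ℓ isDiam 2≤n)
                    (k-lower (gridSize ℓ) d c B diam)
  ... | k′ , k≡1+k′ , D<M , detours≤ =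
    algorithm , feasible ,
    -- With P = 2 ^ k′ and T = 2 ^ k′ ∸ `diam`, both T + `diam` = P and 2 * P = 2 ^ k hold.
    competitive ∈-neighbours length-neighbours (pathLength≤diam ℓ isDiam) (2 ^ k′ ∸ diam) {{T≢0}}
      (≤-reflexive (m∸n+n≡m (<⇒≤ D<M)))
      (≤-reflexive (cong (2 ^_) (sym k≡1+k′)))
      (subst (λ x → diam * (x * (B + d * c)) ≤ (2 ^ k′ ∸ diam) * c) (sym (length-allVertices ℓ)) detours≤) ,
    nonPreemptive
    where
    T≢0 : NonZero (2 ^ k′ ∸ diam)
    T≢0 = >-nonZero (m<n⇒0<n∸m D<M)
    k≢0 : NonZero k
    k≢0 = subst NonZero (sym k≡1+k′) it
    open Online (Grid ℓ) _≤ⱽ_ c B (grid-edge? ℓ) (allVertices ℓ) ∈-allVertices k {{k≢0}} k≤c k≤B (2 ^ k′)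

competitive-mono : ∀ {d} (ℓ : Vec ℕ d) c B {ρ ρ′} A → ρ ≤ ρ′ →
                   GridRouting.Competitive ℓ c B ρ A → GridRouting.Competitive ℓ c B ρ′ A
competitive-mono ℓ c B A ρ≤ρ′ competitive σ with competitive σ
... | a , throughput , o≤ρ*a = a , throughput , λ o opt → ≤-trans (o≤ρ*a o opt) (*-monoˡ-≤ a ρ≤ρ′)

theorem6p3 : ∀ (d : ℕ) → 1 ≤ d → ∀ (C : ℝ) → Positive C →
    ∃ λ (K : ℕ) →
    ∀ (ℓ : Vec ℕ d) (c B diam : ℕ) .{{_ : NonZero c}} →
    2 ≤ gridSize ℓ →
    IsDiameter (Grid ℓ) diam →
    RatioAtMostPower B c (gridSize ℓ) C →
    Parameters.k (gridSize ℓ) d c B diam ≤ B →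
    Parameters.k (gridSize ℓ) d c B diam ≤ c →
    ∃ λ (A : GridRouting.OnlineAlgorithm ℓ c B) →
    GridRouting.AlwaysFeasible ℓ c B A ×
    GridRouting.Competitive ℓ c B (K * ⌊log₂ gridSize ℓ ⌋) A ×
    GridRouting.NonPreemptive ℓ c B A
theorem6p3 d _ C _ = 1 + 16 * e , λ ℓ c B diam 2≤n isDiam ratio k≤B k≤c →
  let n = gridSize ℓ
      B≤ = ratio-bound B c n C {{>-nonZero (<⇒≤ 2≤n)}} ratio
      A , feasible , competitive , nonPreemptive = grid-algorithm ℓ c B diam 2≤n isDiam k≤B k≤c
      ρ≤ = logarithmic n e (Parameters.k n d c B diam) 2≤n λ m → k-upper n d c B diam
             (polynomial-bound n d p c B diam 2≤n (diam<gridSize ℓ isDiam) B≤)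
  in A , feasible , competitive-mono ℓ c B A ρ≤ competitive , nonPreemptive
  where
  -- The numerator of a rational above C. Thus e depends on d and C only, and K is fixed before the
  -- grid is given.
  p = ℤ.∣ ↥ proj₁ (upperNonempty C) ∣
  e = 7 + (d + p)
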